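{- There is a first order sentence $\phi$ over a vocabulary consisting of only one ternary relation symbol such that the sequence $Sp_{\phi}(n)$ is not MC-finite.
   Context: Notation: $[n]=\{1,\ldots,n\}$. For a sentence $\phi$ over a single ternary relation symbol $R$, $Sp_{\phi}(n)=|\{A\subseteq[n]^3 : ([n],A)\models\phi\}|$, the number of interpretations of $R$ on $[n]$ that satisfy $\phi$. First order logic includes equality. MC-finite: an integer sequence $s(n)$ is MC-finite if for every positive integer $m$ it satisfies a linear recurrence with constant coefficients modulo $m$: there are $r(m),p(m)\in\mathbb{N}^+$ and integers $\alpha_0,\ldots,\alpha_{p(m)}$ (depending on $m$) such that $s(n+p(m)+1)\equiv\sum_{i=0}^{p(m)}\alpha_i\, s(n+i)\pmod m$ for all $n\ge r(m)$. Equivalently, for every $m$ the sequence $s(n)\bmod m$ is ultimately periodic. -}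

module Defs where

import Algebra.Properties.CommutativeMonoid.Sum as Sum
open import Data.Bool using (true; false)
open import Data.Fin using (Fin; toℕ)
open import Data.Fin.Properties using (_≟_; all?; any?)
open import Data.Fin.Subset using (Subset; _∈_)
open import Data.Fin.Subset.Properties using (_∈?_)
open import Data.Integer as ℤ using (ℤ; +_)
open import Data.Integer.Divisibility using (_∣_)
open import Data.Integer.Properties using (+-0-commutativeMonoid)
open import Data.List using (List; []; _∷_; length; filter; cartesianProductWith)
import Data.List.Membership.Propositional as List
open import Data.List.Membership.Propositional.Properties using (∈-cartesianProductWith⁺)
open import Data.List.Relation.Unary.All using ([]; _∷_)
open import Data.List.Relation.Unary.AllPairs using ([]; _∷_)
open import Data.List.Relation.Unary.Any using (here; there)
open import Data.List.Relation.Unary.Unique.Propositional using (Unique)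
open import Data.List.Relation.Unary.Unique.Propositional.Properties using (cartesianProductWith⁺)
open import Data.Nat using (ℕ; zero; suc; _+_; _≤_)
open import Data.Product using (Σ-syntax; ∃-syntax; _×_)
open import Data.Sum using (_⊎_)
open import Data.Vec using (Vec; []; _∷_; lookup)
open import Data.Vec.Properties using (∷-injective)
open import Relation.Binary.PropositionalEquality using (_≡_; refl)
open import Relation.Nullary using (¬_; Dec; ¬?; _×-dec_; _⊎-dec_; _→-dec_)

open Sum +-0-commutativeMonoid using (sum-syntax)

-- First order logic with equality over one ternary relation symbol.  The
-- vocabulary has no function symbols, so every term is a variable; variables
-- are de Bruijn indices, k being the number of variables in scope.

infix  8 _≐_
infix  7 ¬ᶠ_
infixr 6 _∧ᶠ_
infixr 5 _∨ᶠ_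
infixr 4 _⇒ᶠ_
infix  3 ∀ᶠ_ ∃ᶠ_

data Formula (k : ℕ) : Set where
  R     : (x y z : Fin k) → Formula k
  _≐_   : (x y : Fin k) → Formula k
  ¬ᶠ_   : Formula k → Formula k
  _∧ᶠ_  : Formula k → Formula k → Formula k
  _∨ᶠ_  : Formula k → Formula k → Formula k
  _⇒ᶠ_  : Formula k → Formula k → Formula k
  ∀ᶠ_   : Formula (suc k) → Formula k
  ∃ᶠ_   : Formula (suc k) → Formula k

Sentence : Set
Sentence = Formula 0

-- [n] is represented by Fin n.  A set A ⊆ [n]³ is given by its sections
-- { z | (x , y , z) ∈ A }, so that distinct elements of TernaryRelation n are
-- distinct relations (which functions into Bool or Set would not guarantee).

TernaryRelation : ℕ → Set
TernaryRelation n = Vec (Vec (Subset n) n) n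

section : ∀ {n} → TernaryRelation n → Fin n → Fin n → Subset n
section A x y = lookup (lookup A x) y

-- Satisfaction is decidable (sat? below), so reading the connectives
-- constructively agrees with the classical semantics.

infix 2 _,_⊨_ _⊨_

_,_⊨_ : ∀ {n k} → TernaryRelation n → Vec (Fin n) k → Formula k → Set
A , ρ ⊨ R x y z  = lookup ρ z ∈ section A (lookup ρ x) (lookup ρ y)
A , ρ ⊨ x ≐ y    = lookup ρ x ≡ lookup ρ y
A , ρ ⊨ ¬ᶠ φ     = ¬ (A , ρ ⊨ φ)
A , ρ ⊨ φ ∧ᶠ ψ   = (A , ρ ⊨ φ) × (A , ρ ⊨ ψ)
A , ρ ⊨ φ ∨ᶠ ψ   = (A , ρ ⊨ φ) ⊎ (A , ρ ⊨ ψ)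
A , ρ ⊨ φ ⇒ᶠ ψ   = (A , ρ ⊨ φ) → (A , ρ ⊨ ψ)
A , ρ ⊨ ∀ᶠ φ     = ∀ a → A , a ∷ ρ ⊨ φ
A , ρ ⊨ ∃ᶠ φ     = ∃[ a ] (A , a ∷ ρ ⊨ φ)

_⊨_ : ∀ {n} → TernaryRelation n → Sentence → Set
A ⊨ φ = A , [] ⊨ φ

sat? : ∀ {n k} (A : TernaryRelation n) (ρ : Vec (Fin n) k) (φ : Formula k) →
       Dec (A , ρ ⊨ φ)
sat? A ρ (R x y z)  = lookup ρ z ∈? section A (lookup ρ x) (lookup ρ y)
sat? A ρ (x ≐ y)    = lookup ρ x ≟ lookup ρ y
sat? A ρ (¬ᶠ φ)     = ¬? (sat? A ρ φ)
sat? A ρ (φ ∧ᶠ ψ)   = sat? A ρ φ ×-dec sat? A ρ ψ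
sat? A ρ (φ ∨ᶠ ψ)   = sat? A ρ φ ⊎-dec sat? A ρ ψ
sat? A ρ (φ ⇒ᶠ ψ)   = sat? A ρ φ →-dec sat? A ρ ψ
sat? A ρ (∀ᶠ φ)     = all? λ a → sat? A (a ∷ ρ) φ
sat? A ρ (∃ᶠ φ)     = any? λ a → sat? A (a ∷ ρ) φ

allVecs : ∀ {A : Set} → List A → ∀ n → List (Vec A n)
allVecs xs zero    = [] ∷ []
allVecs xs (suc n) = cartesianProductWith _∷_ xs (allVecs xs n)

allRelations : ∀ n → List (TernaryRelation n)
allRelations n = allVecs (allVecs (allVecs (true ∷ false ∷ []) n) n) n

-- The list allRelations n contains every relation exactly once
-- (allRelations-complete, allRelations-unique), so this is the number of
-- A ⊆ [n]³ with ([n] , A) ⊨ φ.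

Sp : Sentence → ℕ → ℕ
Sp φ n = length (filter (λ A → sat? A [] φ) (allRelations n))

allVecs-complete : ∀ {A : Set} {xs : List A} → (∀ x → x List.∈ xs) →
                   ∀ {n} (v : Vec A n) → v List.∈ allVecs xs n
allVecs-complete all∈ []      = here refl
allVecs-complete all∈ (x ∷ v) =
  ∈-cartesianProductWith⁺ _∷_ (all∈ x) (allVecs-complete all∈ v)

allVecs-unique : ∀ {A : Set} {xs : List A} → Unique xs → ∀ n → Unique (allVecs xs n)
allVecs-unique xs! zero    = [] ∷ []
allVecs-unique xs! (suc n) =
  cartesianProductWith⁺ _∷_ ∷-injective xs! (allVecs-unique xs! n)

allRelations-complete : ∀ {n} (A : TernaryRelation n) → A List.∈ allRelations n
allRelations-complete = allVecs-complete (allVecs-complete (allVecs-complete all∈))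
  where
  all∈ : ∀ b → b List.∈ (true ∷ false ∷ [])
  all∈ true  = here refl
  all∈ false = there (here refl)

allRelations-unique : ∀ n → Unique (allRelations n)
allRelations-unique n = allVecs-unique (allVecs-unique (allVecs-unique bools! n) n) n
  where
  bools! : Unique (true ∷ false ∷ [])
  bools! = ((λ ()) ∷ []) ∷ [] ∷ []

infix 4 _≡_[mod_]

_≡_[mod_] : ℤ → ℤ → ℕ → Set
a ≡ b [mod m ] = + m ∣ a ℤ.- b

MCFinite : (ℕ → ℤ) → Set
MCFinite s =
  ∀ (m : ℕ) → 1 ≤ m →
  ∃[ r ] ∃[ p ] 1 ≤ r × 1 ≤ p ×
  Σ[ α ∈ (Fin (suc p) → ℤ) ]
    (∀ n → r ≤ n →
      s (n + p + 1) ≡ (∑[ i < suc p ] (α i ℤ.* s (n + toℕ i))) [mod m ])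

{-# OPTIONS --safe #-}

-- The sequence is not ultimately periodic modulo 2.  The sentence says that R
-- encodes a binary tree with leaves [n], through "x and y are closer to each
-- other than to z", and moreover a bit f(d(x,y), d(x,z)) for each such triple,
-- where d is the height of the least common ancestor as seen from the leaf x.
-- Local rules force f(i, i') to hold iff i + i' is a power of 2, and the
-- depth l of every leaf has to satisfy f(0, l); so l is a power of 2.
--
-- Let n = 2^k + j.  The cyclic group generated by a 2^k-cycle of [n] acts on
-- the models, so their number has the same parity as the number of models
-- invariant under the cycle.  In an invariant model the moved points form a
-- complete binary subtree of depth k.  If j = 0 and k is a power of 2, there is
-- exactly one such model.  If 0 < j < k and k is a power of 2, there is none:
-- the depth of a moved point is k + e with 1 ≤ e ≤ j, not a power of 2.
-- Hence arbitrarily long runs of even values are followed by odd values.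

module Submission where

open import Defs
import Algebra.Properties.CommutativeMonoid.Sum as Sum
open import Data.Bool using (Bool; true; false)
import Data.Bool.Properties as Bool
open import Data.Empty using (⊥; ⊥-elim)
open import Data.Fin as Fin using (Fin; zero; suc; toℕ)
open import Data.Fin.Patterns using (0F; 1F; 2F; 3F; 4F)
open import Data.Fin.Properties using (pigeonhole; toℕ<n; 2↔Bool; *↔×; +↔⊎)
open import Data.Fin.Subset renaming (_∈_ to _∈ˢ_) using ()
open import Data.Integer as ℤ using (ℤ; +_)
open import Data.Integer.Divisibility.Signed
  using (_∣_; divides; ∣m∣n⇒∣m+n; ∣m+n∣n⇒∣m; ∣m+n∣m⇒∣n; ∣m⇒∣-m; ∣n⇒∣m*n; ∣ᵤ⇒∣; ∣⇒∣ᵤ)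
import Data.Integer.Properties as ℤ
open import Data.List using (List; []; _∷_; _++_; length; filter)
open import Data.List.Membership.Propositional using (_∈_)
open import Data.List.Membership.Propositional.Properties using (∈-∃++; ∈-filter⁺; ∈-filter⁻)
open import Data.List.Properties using (filter-none; filter-reject; filter-≐)
open import Data.List.Relation.Binary.Permutation.Propositional using (_↭_; ↭-sym; ↭⇒↭ₛ)
import Data.List.Relation.Binary.Permutation.Propositional.Properties as ↭
import Data.List.Relation.Binary.Permutation.Setoid.Properties as ↭ₛ
import Data.List.Relation.Unary.All as All
open import Data.List.Relation.Unary.AllPairs using ([]; _∷_)
open import Data.List.Relation.Unary.Any using (here; there)
open import Data.List.Relation.Unary.Unique.Propositional using (Unique)
open import Data.List.Relation.Unary.Unique.Propositional.Properties using (filter⁺)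
open import Data.Nat
  using (ℕ; zero; suc; _+_; _*_; _^_; _∸_; _<_; _≤_; z≤n; s≤s; _≟_; _<?_; _≤?_; parity)
open import Data.Nat.Divisibility using (∣1⇒≡1)
open import Data.Nat.GeneralisedArithmetic using (fold; fold-+)
open import Data.Nat.Properties
  using (*-cancelˡ-≡; +-assoc; +-comm; +-identityʳ; +-mono-≤; +-monoˡ-<; +-suc; <-asym; <-cmp;
         <-irrefl; <-trans; <-≤-trans; <⇒≤; <⇒≱; ^-monoʳ-<; ^-monoʳ-≤; anyUpTo?; even≢odd;
         m+[n∸m]≡n; m<m+n; m^n>0; m^n≢0; m≤m+n; m≤n+m; m≤n⇒m≤1+n; n<1+n; n≤1+n; ≤-<-trans;
         ≤-antisym; ≤-pred; ≤-refl; ≤-reflexive; ≤-trans; ≤∧≢⇒<; ≮⇒≥; ≰⇒>)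
open import Data.Parity using (0ℙ; 1ℙ; _⁻¹)
open import Data.Parity.Properties using (+-homo-+)
open import Data.Product using (Σ-syntax; ∃-syntax; _×_; _,_; proj₁; proj₂; swap; uncurry)
open import Data.Product.Function.NonDependent.Propositional using (_×-↔_)
open import Data.Sum as ⊎ using (_⊎_; inj₁; inj₂)
open import Data.Sum.Function.Propositional using (_⊎-↔_)
open import Data.Sum.Properties using (inj₁-injective)
open import Data.Vec using (Vec; []; _∷_; lookup; map; replicate; tabulate; uncons)
open import Data.Vec.Properties
  using (∷-injectiveʳ; ≡-dec; lookup-map; lookup∘tabulate; tabulate∘lookup; tabulate-cong;
         lookup⇒[]=; []=⇒lookup)
open import Function using (_∘_; id; _↔_; Inverse; mk⇔; mk↔ₛ′)
open import Function.Properties.Inverse using (↔-refl; ↔-sym; ↔-trans)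
open import Level using (0ℓ)
open import Relation.Binary using (DecidableEquality; tri<; tri≈; tri>)
open import Relation.Binary.PropositionalEquality
  using (_≡_; _≢_; refl; sym; trans; cong; cong₂; subst; subst₂; setoid; module ≡-Reasoning)
open import Relation.Nullary using (¬_; Dec; does; yes; no; map′; _×-dec_; _⊎-dec_)
open import Relation.Nullary.Decidable using (dec-true)
open import Relation.Unary using (Pred; Decidable)

open Sum ℤ.+-0-commutativeMonoid using (sum)

-- Parity of the number of fixed points

module _ {A : Set} (_≟_ : DecidableEquality A) where

  private
    Unique-resp-↭ : ∀ {xs ys : List A} → xs ↭ ys → Unique xs → Unique ys
    Unique-resp-↭ xs↭ys = ↭ₛ.Unique-resp-↭ (setoid A) (↭⇒↭ₛ xs↭ys)

    ∈⇒↭ : ∀ {x : A} {xs} → x ∈ xs → ∃[ ys ] xs ↭ x ∷ ys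
    ∈⇒↭ x∈xs with ys , zs , refl ← ∈-∃++ x∈xs = ys ++ zs , ↭.shift _ ys zs

  fixed? : (g : A → A) → Decidable (λ x → g x ≡ x)
  fixed? g x = g x ≟ x

  -- The points that `g` moves pair off as `x` and `g x`. A fixed head is removed alone, a moved
  -- head together with its partner. The partner may sit anywhere in the tail, so `go` recurses on a
  -- bound for the length.
  involution-parity :
    ∀ (g : A → A) {xs} → Unique xs →
    (∀ {x} → x ∈ xs → g x ∈ xs) → (∀ {x} → x ∈ xs → g (g x) ≡ x) →
    parity (length xs) ≡ parity (length (filter (fixed? g) xs))
  involution-parity g {xs} xs! = go (length xs) xs ≤-refl xs!
    where
    go : ∀ n xs → length xs ≤ n → Unique xs →
         (∀ {x} → x ∈ xs → g x ∈ xs) → (∀ {x} → x ∈ xs → g (g x) ≡ x) →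
         parity (length xs) ≡ parity (length (filter (fixed? g) xs))
    go _ [] _ _ _ _ = refl
    go (suc n) (x ∷ xs) (s≤s ≤n) (x∉xs ∷ xs!) closed invol with g x ≟ x
    ... | yes gx≡x = begin
      parity (suc (length xs))
        ≡⟨ +-homo-+ 1 (length xs) ⟩
      parity (length xs) ⁻¹
        ≡⟨ cong _⁻¹ (go n xs ≤n xs! closed′ (invol ∘ there)) ⟩
      parity (length (filter (fixed? g) xs)) ⁻¹
        ≡⟨ +-homo-+ 1 (length (filter (fixed? g) xs)) ⟨
      parity (suc (length (filter (fixed? g) xs))) ∎
      where
      open ≡-Reasoning
      closed′ : ∀ {y} → y ∈ xs → g y ∈ xs
      closed′ {y} y∈xs with closed (there y∈xs)
      ... | there gy∈xs = gy∈xs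
      ... | here gy≡x   = ⊥-elim (All.lookup x∉xs y∈xs
        (trans (sym gx≡x) (trans (cong g (sym gy≡x)) (invol (there y∈xs)))))
    ... | no gx≢x with closed (here refl)
    ...   | here gx≡x = ⊥-elim (gx≢x gx≡x)
    ...   | there gx∈xs
      with ys , xs↭ ← ∈⇒↭ gx∈xs with gx∉ys ∷ ys! ← Unique-resp-↭ xs↭ xs! = begin
      parity (suc (length xs))
        ≡⟨ cong (parity ∘ suc) (↭.↭-length xs↭) ⟩
      parity (length ys)
        ≡⟨ go n ys (≤-trans (n≤1+n _) (≤-trans (≤-reflexive (sym (↭.↭-length xs↭))) ≤n))
             ys! closed′ (invol ∘ ys⊆) ⟩
      parity (length (filter (fixed? g) ys))
        ≡⟨ cong (parity ∘ length) (filter-reject (fixed? g) ggx≢gx) ⟨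
      parity (length (filter (fixed? g) (g x ∷ ys)))
        ≡⟨ cong parity (↭.↭-length (↭.filter-↭ (fixed? g) xs↭)) ⟨
      parity (length (filter (fixed? g) xs)) ∎
      where
      open ≡-Reasoning
      ys⊆ : ∀ {y} → y ∈ ys → y ∈ x ∷ xs
      ys⊆ y∈ys = there (↭.∈-resp-↭ (↭-sym xs↭) (there y∈ys))
      ggx≢gx : g (g x) ≢ g x
      ggx≢gx eq = gx≢x (trans (sym eq) (invol (here refl)))
      closed′ : ∀ {y} → y ∈ ys → g y ∈ ys
      closed′ {y} y∈ys with closed (ys⊆ y∈ys)
      ... | here gy≡x = ⊥-elim (All.lookup gx∉ys y∈ys
        (trans (cong g (sym gy≡x)) (invol (ys⊆ y∈ys))))
      ... | there gy∈xs with ↭.∈-resp-↭ xs↭ gy∈xs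
      ...   | there gy∈ys = gy∈ys
      ...   | here gy≡gx  = ⊥-elim (All.lookup x∉xs (↭.∈-resp-↭ (↭-sym xs↭) (there y∈ys))
        (trans (sym (invol (here refl))) (trans (cong g (sym gy≡gx)) (invol (ys⊆ y∈ys)))))

  filter-∩ : ∀ {P Q : Pred A 0ℓ} (P? : Decidable P) (Q? : Decidable Q) xs →
             filter Q? (filter P? xs) ≡ filter (λ x → P? x ×-dec Q? x) xs
  filter-∩ P? Q? [] = refl
  filter-∩ P? Q? (x ∷ xs) with P? x
  ... | no _ = filter-∩ P? Q? xs
  ... | yes _ with Q? x
  ...   | yes _ = cong (x ∷_) (filter-∩ P? Q? xs)
  ...   | no _  = filter-∩ P? Q? xs

  -- g ∘ g has order 2 ^ (i - 1), and g is an involution on its fixed points.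
  cyclic-parity :
    ∀ {xs} → Unique xs → (∀ x → x ∈ xs) →
    ∀ i (g : A → A) {P : Pred A 0ℓ} (P? : Decidable P) →
    (∀ {x} → P x → P (g x)) → (∀ {x} → P x → fold x g (2 ^ i) ≡ x) →
    parity (length (filter P? xs)) ≡
    parity (length (filter (λ x → P? x ×-dec fixed? g x) xs))
  cyclic-parity {xs} _ _ zero g P? _ order =
    cong (parity ∘ length) (filter-≐ P? (λ x → P? x ×-dec fixed? g x)
      ((λ px → px , order px) , proj₁) xs)
  cyclic-parity {xs} xs! all∈ (suc i) g {P} P? closed order = begin
    parity (length (filter P? xs))
      ≡⟨ cyclic-parity xs! all∈ i (g ∘ g) P? (closed ∘ closed)
           (λ {x} px → trans (fold-∘ x (2 ^ i)) (trans (cong (λ n → fold x g (2 ^ i + n))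
             (sym (+-identityʳ (2 ^ i)))) (order px))) ⟩
    parity (length (filter Q? xs))
      ≡⟨ involution-parity g (filter⁺ Q? xs!)
           (λ x∈ → let px , ggx≡x = proj₂ (∈-filter⁻ Q? {xs = xs} x∈) in
             ∈-filter⁺ Q? (all∈ _) (closed px , cong g ggx≡x))
           (λ x∈ → proj₂ (proj₂ (∈-filter⁻ Q? {xs = xs} x∈))) ⟩
    parity (length (filter (fixed? g) (filter Q? xs)))
      ≡⟨ cong (parity ∘ length) (filter-∩ Q? (fixed? g) xs) ⟩
    parity (length (filter (λ x → Q? x ×-dec fixed? g x) xs))
      ≡⟨ cong (parity ∘ length) (filter-≐ (λ x → Q? x ×-dec fixed? g x)
           (λ x → P? x ×-dec fixed? g x)
           ( (λ ((px , _) , gx≡x) → px , gx≡x)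
           , (λ (px , gx≡x) → (px , trans (cong g gx≡x) gx≡x) , gx≡x)) xs) ⟩
    parity (length (filter (λ x → P? x ×-dec fixed? g x) xs)) ∎
    where
    open ≡-Reasoning
    Q? : Decidable (λ x → P x × g (g x) ≡ x)
    Q? x = P? x ×-dec fixed? (g ∘ g) x
    fold-∘ : ∀ x n → fold x (g ∘ g) n ≡ fold x g (n + n)
    fold-∘ x zero = refl
    fold-∘ x (suc n) rewrite +-suc n n = cong (g ∘ g) (fold-∘ x n)

length-singleton : ∀ {A : Set} {x : A} {xs} → Unique xs → x ∈ xs →
                   (∀ {y} → y ∈ xs → y ≡ x) → length xs ≡ 1
length-singleton {xs = _ ∷ []} _ _ _ = refl
length-singleton {xs = _ ∷ _ ∷ _} ((y≢z All.∷ _) ∷ _) _ ≡x =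
  ⊥-elim (y≢z (trans (≡x (here refl)) (sym (≡x (there (here refl))))))

-- Relations and their images under permutations

infix 1 _⟺_

-- Unlike the library's _⇔_, this is definitionally the meaning of _⇔ᶠ_ below.

_⟺_ : Set → Set → Set
A ⟺ B = (A → B) × (B → A)

holds : ∀ {n} → TernaryRelation n → Fin n → Fin n → Fin n → Bool
holds A x y z = lookup (section A x y) z

relation : ∀ {n} → (Fin n → Fin n → Fin n → Bool) → TernaryRelation n
relation f = tabulate λ x → tabulate λ y → tabulate (f x y)

holds-relation : ∀ {n} (f : Fin n → Fin n → Fin n → Bool) x y z →
                 holds (relation f) x y z ≡ f x y z
holds-relation f x y z
  rewrite lookup∘tabulate (λ x → tabulate λ y → tabulate (f x y)) x
        | lookup∘tabulate (λ y → tabulate (f x y)) y = lookup∘tabulate (f x y) z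

relation-holds : ∀ {n} (A : TernaryRelation n) → relation (holds A) ≡ A
relation-holds A = trans (tabulate-cong λ x → trans (tabulate-cong λ y →
  tabulate∘lookup (section A x y)) (tabulate∘lookup (lookup A x))) (tabulate∘lookup A)

holds-injective : ∀ {n} {A B : TernaryRelation n} →
                  (∀ x y z → holds A x y z ≡ holds B x y z) → A ≡ B
holds-injective {A = A} {B} A≗B = begin
  A                    ≡⟨ relation-holds A ⟨
  relation (holds A)   ≡⟨ tabulate-cong (λ x → tabulate-cong λ y → tabulate-cong (A≗B x y)) ⟩
  relation (holds B)   ≡⟨ relation-holds B ⟩
  B                    ∎
  where open ≡-Reasoning

∈⇒holds : ∀ {n} (A : TernaryRelation n) {x y z} → z ∈ˢ section A x y → holds A x y z ≡ true
∈⇒holds A = []=⇒lookup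

holds⇒∈ : ∀ {n} (A : TernaryRelation n) {x y z} → holds A x y z ≡ true → z ∈ˢ section A x y
holds⇒∈ A {x} {y} {z} = lookup⇒[]= z (section A x y)

pullback : ∀ {n} → (Fin n → Fin n) → TernaryRelation n → TernaryRelation n
pullback σ A = relation λ x y z → holds A (σ x) (σ y) (σ z)

holds-fold-pullback : ∀ {n} (σ : Fin n → Fin n) A m x y z →
  holds (fold A (pullback σ) m) x y z ≡ holds A (fold x σ m) (fold y σ m) (fold z σ m)
holds-fold-pullback σ A zero x y z = refl
holds-fold-pullback σ A (suc m) x y z = begin
  holds (pullback σ (fold A (pullback σ) m)) x y z
    ≡⟨ holds-relation _ x y z ⟩
  holds (fold A (pullback σ) m) (σ x) (σ y) (σ z)
    ≡⟨ holds-fold-pullback σ A m _ _ _ ⟩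
  holds A (fold (σ x) σ m) (fold (σ y) σ m) (fold (σ z) σ m)
    ≡⟨ cong (λ w → holds A w (fold (σ y) σ m) (fold (σ z) σ m)) (fold-comm x m) ⟩
  holds A (σ (fold x σ m)) (fold (σ y) σ m) (fold (σ z) σ m)
    ≡⟨ cong₂ (holds A _) (fold-comm y m) (fold-comm z m) ⟩
  holds A (σ (fold x σ m)) (σ (fold y σ m)) (σ (fold z σ m)) ∎
  where
  open ≡-Reasoning
  fold-comm : ∀ w m → fold (σ w) σ m ≡ σ (fold w σ m)
  fold-comm w zero    = refl
  fold-comm w (suc m) = cong σ (fold-comm w m)

module _ {n} (σ : Fin n → Fin n) (σ-inj : ∀ {x y} → σ x ≡ σ y → x ≡ y)
         (σ-surj : ∀ y → ∃[ x ] σ x ≡ y) (A : TernaryRelation n) where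

  pullback-∈ : ∀ {x y z} → (z ∈ˢ section (pullback σ A) x y) ⟺ (σ z ∈ˢ section A (σ x) (σ y))
  pullback-∈ {x} {y} {z} =
    (λ z∈ → holds⇒∈ A (trans (sym (holds-relation _ x y z)) (∈⇒holds (pullback σ A) z∈))) ,
    (λ z∈ → holds⇒∈ (pullback σ A) (trans (holds-relation _ x y z) (∈⇒holds A z∈)))

  -- `σ` is an isomorphism from the pullback onto `A`. Injectivity serves the equality atoms,
  -- surjectivity the quantifiers.
  pullback-⊨ : ∀ {k} (ρ : Vec (Fin n) k) φ → _,_⊨_ (pullback σ A) ρ φ ⟺ _,_⊨_ A (map σ ρ) φ
  pullback-⊨ ρ (R x y z)
    rewrite lookup-map x σ ρ | lookup-map y σ ρ | lookup-map z σ ρ = pullback-∈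
  pullback-⊨ ρ (x ≐ y)
    rewrite lookup-map x σ ρ | lookup-map y σ ρ = cong σ , σ-inj
  pullback-⊨ ρ (¬ᶠ φ) with f , g ← pullback-⊨ ρ φ = (_∘ g) , (_∘ f)
  pullback-⊨ ρ (φ ∧ᶠ ψ) with f , g ← pullback-⊨ ρ φ | f′ , g′ ← pullback-⊨ ρ ψ =
    (λ (a , b) → f a , f′ b) , (λ (a , b) → g a , g′ b)
  pullback-⊨ ρ (φ ∨ᶠ ψ) with f , g ← pullback-⊨ ρ φ | f′ , g′ ← pullback-⊨ ρ ψ =
    ⊎.map f f′ , ⊎.map g g′
  pullback-⊨ ρ (φ ⇒ᶠ ψ) with f , g ← pullback-⊨ ρ φ | f′ , g′ ← pullback-⊨ ρ ψ =
    (λ h → f′ ∘ h ∘ g) , (λ h → g′ ∘ h ∘ f)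
  pullback-⊨ ρ (∀ᶠ φ) =
    (λ h b → let a , σa≡b = σ-surj b in
      subst (λ b → _,_⊨_ A (b ∷ map σ ρ) φ) σa≡b (proj₁ (pullback-⊨ (a ∷ ρ) φ) (h a))) ,
    (λ h a → proj₂ (pullback-⊨ (a ∷ ρ) φ) (h (σ a)))
  pullback-⊨ ρ (∃ᶠ φ) =
    (λ (a , p) → σ a , proj₁ (pullback-⊨ (a ∷ ρ) φ) p) ,
    (λ (b , p) → let a , σa≡b = σ-surj b in
      a , proj₂ (pullback-⊨ (a ∷ ρ) φ) (subst (λ b → _,_⊨_ A (b ∷ map σ ρ) φ) (sym σa≡b) p))

-- The sentence

infix 3 _⇔ᶠ_

_⇔ᶠ_ : ∀ {k} → Formula k → Formula k → Formula k
φ ⇔ᶠ ψ = (φ ⇒ᶠ ψ) ∧ᶠ (ψ ⇒ᶠ φ)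

-- d(x,y) < d(x,z).  In this situation R z x y, R z y x hold and R x z y, R y z x
-- fail, which leaves R x y z free to store the bit f(d(x,y), d(x,z)).
closerᶠ : ∀ {k} (x y z : Fin k) → Formula k
closerᶠ x y z = R z x y ∧ᶠ R z y x

-- d(x,z) = d(x,y) + 1
nextᶠ : ∀ {k} (x y z : Fin k) → Formula k
nextᶠ x y z = closerᶠ x y z ∧ᶠ
  ¬ᶠ (∃ᶠ closerᶠ (suc x) (suc y) 0F ∧ᶠ closerᶠ (suc x) 0F (suc z))

module _ {X : Set} (r : X → X → X → Set) where

  Closer : X → X → X → Set
  Closer x y z = r z x y × r z y x

  Next : X → X → X → Set
  Next x y z = Closer x y z × ¬ (∃[ w ] Closer x y w × Closer x w z)

-- The rules for f are f(i, i + 1) iff i = 0 (diag), f(i, i + 2) iff f(0, i + 1)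
-- (halve), f(i, i' + 1) iff f(i + 1, i') for i + 1 < i' (shift).
record Model {X : Set} (r : X → X → X → Set) : Set where
  field
    asym    : ∀ x y z → Closer r x y z → ¬ Closer r x z y
    split   : ∀ x y z w → Closer r x y z → Closer r x y w ⊎ Closer r w y z
    binary  : ∀ x y z → Closer r x y z ⊎ Closer r y z x ⊎ Closer r x z y ⊎ (x ≡ y × x ≡ z)
    -- Every triple of `r` is thus one half of an encoded `Closer r y z x`, or a bit stored where
    -- `Closer r x y z` holds.
    tight   : ∀ x y z → r x y z → r x z y ⊎ Closer r x y z
    diag    : ∀ x y z → Next r x y z → r x y z ⟺ x ≡ y
    halve   : ∀ x y y′ z → Next r x y y′ × Next r x y′ z → r x y z ⟺ r x x y′
    shift   : ∀ x y y′ z z′ → Next r x y y′ × Next r x z z′ × Closer r x y′ z →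
              r x y z′ ⟺ r x y′ z
    next    : ∀ x z w → Closer r x z w → ∃[ w′ ] Next r x z w′
    -- Nothing lies beyond `z`, so d(x,z) is the depth l of `x`; as d(x,x) = 0, this demands f(0,
    -- l).
    top     : ∀ x z → ¬ (∃[ w ] Closer r x z w) → r x x z

treeSentence : Sentence
treeSentence =
  (∀ᶠ ∀ᶠ ∀ᶠ (closerᶠ 2F 1F 0F ⇒ᶠ ¬ᶠ closerᶠ 2F 0F 1F)) ∧ᶠ
  (∀ᶠ ∀ᶠ ∀ᶠ ∀ᶠ (closerᶠ 3F 2F 1F ⇒ᶠ closerᶠ 3F 2F 0F ∨ᶠ closerᶠ 0F 2F 1F)) ∧ᶠ
  (∀ᶠ ∀ᶠ ∀ᶠ (closerᶠ 2F 1F 0F ∨ᶠ closerᶠ 1F 0F 2F ∨ᶠ closerᶠ 2F 0F 1F ∨ᶠ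
    2F ≐ 1F ∧ᶠ 2F ≐ 0F)) ∧ᶠ
  (∀ᶠ ∀ᶠ ∀ᶠ (R 2F 1F 0F ⇒ᶠ R 2F 0F 1F ∨ᶠ closerᶠ 2F 1F 0F)) ∧ᶠ
  (∀ᶠ ∀ᶠ ∀ᶠ (nextᶠ 2F 1F 0F ⇒ᶠ (R 2F 1F 0F ⇔ᶠ 2F ≐ 1F))) ∧ᶠ
  (∀ᶠ ∀ᶠ ∀ᶠ ∀ᶠ (nextᶠ 3F 2F 1F ∧ᶠ nextᶠ 3F 1F 0F ⇒ᶠ (R 3F 2F 0F ⇔ᶠ R 3F 3F 1F))) ∧ᶠ
  (∀ᶠ ∀ᶠ ∀ᶠ ∀ᶠ ∀ᶠ (nextᶠ 4F 3F 2F ∧ᶠ nextᶠ 4F 1F 0F ∧ᶠ closerᶠ 4F 2F 1F ⇒ᶠ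
    (R 4F 3F 0F ⇔ᶠ R 4F 2F 1F))) ∧ᶠ
  (∀ᶠ ∀ᶠ ∀ᶠ (closerᶠ 2F 1F 0F ⇒ᶠ (∃ᶠ nextᶠ 3F 2F 0F))) ∧ᶠ
  (∀ᶠ ∀ᶠ (¬ᶠ (∃ᶠ closerᶠ 2F 1F 0F) ⇒ᶠ R 1F 1F 0F))

module _ {n} (A : TernaryRelation n) where

  Holds : Fin n → Fin n → Fin n → Set
  Holds x y z = z ∈ˢ section A x y

  ⊨⇒Model : A ⊨ treeSentence → Model Holds
  ⊨⇒Model (a , b , c , d , e , f , g , h , i) = record
    { asym = a ; split = b ; binary = c ; tight = d ; diag = e
    ; halve = f ; shift = g ; next = h ; top = i }

  Model⇒⊨ : Model Holds → A ⊨ treeSentence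
  Model⇒⊨ m = asym , split , binary , tight , diag , halve , shift , next , top
    where open Model m

-- The complete binary tree

-- Addition of 1 modulo 2 ^ k, least significant bit first. It is a single cycle on the leaves and
-- an automorphism of the tree whose root separates the heads.
odometer : ∀ {k} → Vec Bool k → Vec Bool k
odometer []          = []
odometer (false ∷ v) = true ∷ v
odometer (true  ∷ v) = false ∷ odometer v

-- The height of the least common ancestor; the root separates the heads.
level : ∀ {k} → Vec Bool k → Vec Bool k → ℕ
level [] [] = 0
level {suc k} (false ∷ v) (false ∷ w) = level v w
level {suc k} (true  ∷ v) (true  ∷ w) = level v w
level {suc k} (false ∷ v) (true  ∷ w) = suc k
level {suc k} (true  ∷ v) (false ∷ w) = suc k

level-≤ : ∀ {k} (v w : Vec Bool k) → level v w ≤ k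
level-≤ [] [] = z≤n
level-≤ (false ∷ v) (false ∷ w) = m≤n⇒m≤1+n (level-≤ v w)
level-≤ (true  ∷ v) (true  ∷ w) = m≤n⇒m≤1+n (level-≤ v w)
level-≤ (false ∷ v) (true  ∷ w) = ≤-refl
level-≤ (true  ∷ v) (false ∷ w) = ≤-refl

level-sym : ∀ {k} (v w : Vec Bool k) → level v w ≡ level w v
level-sym [] [] = refl
level-sym (false ∷ v) (false ∷ w) = level-sym v w
level-sym (true  ∷ v) (true  ∷ w) = level-sym v w
level-sym (false ∷ v) (true  ∷ w) = refl
level-sym (true  ∷ v) (false ∷ w) = refl

level-refl : ∀ {k} (v : Vec Bool k) → level v v ≡ 0
level-refl [] = refl
level-refl (false ∷ v) = level-refl v
level-refl (true  ∷ v) = level-refl v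

level≡0 : ∀ {k} (v w : Vec Bool k) → level v w ≡ 0 → v ≡ w
level≡0 [] [] _ = refl
level≡0 (false ∷ v) (false ∷ w) eq = cong (false ∷_) (level≡0 v w eq)
level≡0 (true  ∷ v) (true  ∷ w) eq = cong (true ∷_) (level≡0 v w eq)

level-surjective : ∀ {k} (v : Vec Bool k) {i} → i ≤ k → ∃[ w ] level v w ≡ i
level-surjective [] {zero} _ = [] , refl
level-surjective {suc k} (b ∷ v) {i} i≤ with i ≟ suc k
level-surjective {suc k} (false ∷ v) {i} i≤ | yes refl = true ∷ v , refl
level-surjective {suc k} (true  ∷ v) {i} i≤ | yes refl = false ∷ v , refl
level-surjective {suc k} (b ∷ v) {i} i≤ | no i≢ with level-surjective v (≤-pred (≤∧≢⇒< i≤ i≢))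
level-surjective {suc k} (false ∷ v) i≤ | no _ | w , eq = false ∷ w , eq
level-surjective {suc k} (true  ∷ v) i≤ | no _ | w , eq = true ∷ w , eq

level-odometer : ∀ {k} (v w : Vec Bool k) → level (odometer v) (odometer w) ≡ level v w
level-odometer [] [] = refl
level-odometer (false ∷ v) (false ∷ w) = refl
level-odometer (true  ∷ v) (true  ∷ w) = level-odometer v w
level-odometer (false ∷ v) (true  ∷ w) = refl
level-odometer (true  ∷ v) (false ∷ w) = refl

-- The isosceles law of an ultrametric: `u` and `v` lie in a common subtree that avoids `w`, so both
-- meet `w` at the same node.
level-ultra : ∀ {k} (u v w : Vec Bool k) → level u v < level u w → level u w ≡ level v w
level-ultra [] [] [] _ = refl
level-ultra (false ∷ u) (false ∷ v) (false ∷ w) p = level-ultra u v w p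
level-ultra (false ∷ u) (false ∷ v) (true  ∷ w) p = refl
level-ultra (false ∷ u) (true  ∷ v) (false ∷ w) p = ⊥-elim (<⇒≱ p (m≤n⇒m≤1+n (level-≤ u w)))
level-ultra (false ∷ u) (true  ∷ v) (true  ∷ w) p = ⊥-elim (<-irrefl refl p)
level-ultra (true  ∷ u) (true  ∷ v) (true  ∷ w) p = level-ultra u v w p
level-ultra (true  ∷ u) (true  ∷ v) (false ∷ w) p = refl
level-ultra (true  ∷ u) (false ∷ v) (true  ∷ w) p = ⊥-elim (<⇒≱ p (m≤n⇒m≤1+n (level-≤ u w)))
level-ultra (true  ∷ u) (false ∷ v) (false ∷ w) p = ⊥-elim (<-irrefl refl p)

-- At the node where the three leaves first part, two of them go to the same child.
level-binary : ∀ {k} (u v w : Vec Bool k) →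
  level u v < level u w ⊎ level v w < level v u ⊎ level u w < level u v ⊎ (u ≡ v × u ≡ w)
level-binary [] [] [] = inj₂ (inj₂ (inj₂ (refl , refl)))
level-binary (false ∷ u) (false ∷ v) (true  ∷ w) = inj₁ (s≤s (level-≤ u v))
level-binary (true  ∷ u) (true  ∷ v) (false ∷ w) = inj₁ (s≤s (level-≤ u v))
level-binary (false ∷ u) (true  ∷ v) (true  ∷ w) = inj₂ (inj₁ (s≤s (level-≤ v w)))
level-binary (true  ∷ u) (false ∷ v) (false ∷ w) = inj₂ (inj₁ (s≤s (level-≤ v w)))
level-binary (false ∷ u) (true  ∷ v) (false ∷ w) = inj₂ (inj₂ (inj₁ (s≤s (level-≤ u w))))
level-binary (true  ∷ u) (false ∷ v) (true  ∷ w) = inj₂ (inj₂ (inj₁ (s≤s (level-≤ u w))))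
level-binary (false ∷ u) (false ∷ v) (false ∷ w) with level-binary u v w
... | inj₁ p = inj₁ p
... | inj₂ (inj₁ p) = inj₂ (inj₁ p)
... | inj₂ (inj₂ (inj₁ p)) = inj₂ (inj₂ (inj₁ p))
... | inj₂ (inj₂ (inj₂ (p , q))) = inj₂ (inj₂ (inj₂ (cong (_ ∷_) p , cong (_ ∷_) q)))
level-binary (true ∷ u) (true ∷ v) (true ∷ w) with level-binary u v w
... | inj₁ p = inj₁ p
... | inj₂ (inj₁ p) = inj₂ (inj₁ p)
... | inj₂ (inj₂ (inj₁ p)) = inj₂ (inj₂ (inj₁ p))
... | inj₂ (inj₂ (inj₂ (p , q))) = inj₂ (inj₂ (inj₂ (cong (_ ∷_) p , cong (_ ∷_) q)))

-- Two increments restore the lowest bit and carry exactly once. Hence the square of the odometer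
-- acts as an odometer on the tails of the vectors with a given head, which drives the inductions on
-- `k`.
fold-odometer-∷ : ∀ {k} b (v : Vec Bool k) m →
                  fold (b ∷ v) odometer (m + m) ≡ b ∷ fold v odometer m
fold-odometer-∷ b v zero = refl
fold-odometer-∷ b v (suc m) rewrite +-suc m m | fold-odometer-∷ b v m with b
... | false = refl
... | true  = refl

odometer-order : ∀ k (v : Vec Bool k) → fold v odometer (2 ^ k) ≡ v
odometer-order zero [] = refl
odometer-order (suc k) (b ∷ v) rewrite +-identityʳ (2 ^ k) =
  trans (fold-odometer-∷ b v (2 ^ k)) (cong (b ∷_) (odometer-order k v))

2^-positive : ∀ k → ∃[ n ] 2 ^ k ≡ suc n
2^-positive k with 2 ^ k | m^n≢0 2 k
... | suc n | _ = n , refl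

odometer-surjective : ∀ {k} (v : Vec Bool k) → ∃[ w ] odometer w ≡ v
odometer-surjective {k} v with n , eq ← 2^-positive k =
  fold v odometer n , trans (cong (fold v odometer) (sym eq)) (odometer-order k v)

odometer-injective : ∀ {k} {v w : Vec Bool k} → odometer v ≡ odometer w → v ≡ w
odometer-injective {v = v} {w} eq = level≡0 v w (begin
  level v w                       ≡⟨ level-odometer v w ⟨
  level (odometer v) (odometer w) ≡⟨ cong (level (odometer v)) eq ⟨
  level (odometer v) (odometer v) ≡⟨ level-refl (odometer v) ⟩
  0                               ∎)
  where open ≡-Reasoning

odometer-reaches : ∀ {k} (v w : Vec Bool k) → ∃[ m ] fold v odometer m ≡ w
odometer-reaches [] [] = 0 , refl
odometer-reaches (false ∷ v) (false ∷ w) with m , refl ← odometer-reaches v w =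
  m + m , fold-odometer-∷ false v m
odometer-reaches (true ∷ v) (true ∷ w) with m , refl ← odometer-reaches v w =
  m + m , fold-odometer-∷ true v m
odometer-reaches (false ∷ v) (true ∷ w) with m , refl ← odometer-reaches v w =
  suc (m + m) , cong odometer (fold-odometer-∷ false v m)
-- The last tick carries into the tail, so the tail first has to reach the predecessor `w′` of `w`.
odometer-reaches (true ∷ v) (false ∷ w)
  with w′ , refl ← odometer-surjective w with m , refl ← odometer-reaches v w′ =
  suc (m + m) , cong odometer (fold-odometer-∷ true v m)

-- Invariant binary trees

module Tree {X : Set} {r : X → X → X → Set} (model : Model r) where
  open Model model

  -- The rooted triple xy|z of a phylogenetic tree, symmetric in `x` and `y` by `swap`.
  T : X → X → X → Set
  T = Closer r

  T-irreflˡ : ∀ {x z} → ¬ T z x x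
  T-irreflˡ {x} {z} t = asym z x x t t

  T-irrefl : ∀ {x z} → ¬ T x z x
  T-irrefl t = T-irreflˡ (swap t)

  T-refl : ∀ {x z} → x ≢ z → T x x z
  T-refl {x} {z} x≢z with binary x x z
  ... | inj₁ t = t
  ... | inj₂ (inj₁ t) = ⊥-elim (T-irrefl t)
  ... | inj₂ (inj₂ (inj₁ t)) = ⊥-elim (T-irrefl t)
  ... | inj₂ (inj₂ (inj₂ (_ , x≡z))) = ⊥-elim (x≢z x≡z)

  -- With `z` fixed, this is transitivity of lying in a common subtree that avoids `z`.
  T-join : ∀ {x y z w} → T x y z → T y w z → T x w z
  T-join {x} {y} {z} {w} xy|z yw|z with split y w z x yw|z
  ... | inj₂ xw|z = xw|z
  ... | inj₁ yw|x with split y x z w (swap xy|z)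
  ...   | inj₂ wx|z = swap wx|z
  ...   | inj₁ yx|w = ⊥-elim (asym y w x yw|x yx|w)

  T-trans : ∀ {x y z w} → T x y z → T x z w → T x y w
  T-trans {x} {y} {z} {w} xy|z xz|w with split x y z w xy|z
  ... | inj₁ xy|w = xy|w
  ... | inj₂ wy|z = ⊥-elim (asym x z w xz|w (T-join xy|z (swap wy|z)))

  module Orbit (σ : X → X) (T-σ : ∀ {x y z} → T x y z → T (σ x) (σ y) (σ z)) (x₀ : X) where

    private
      p q : ℕ → X
      p = fold x₀ σ
      q = fold x₀ (σ ∘ σ)

    -- Otherwise one of `x₀` and `σ x₀` is strictly closer to `c` than the other. Applying `σ`
    -- repeats this along the orbit, so the distance to `c` would vary strictly monotonically,
    -- although the orbit returns to `x₀`. Hence consecutive points are close relative to `c`, and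
    -- `T-join` chains them.
    T-fixed : ∀ N → p (suc N) ≡ x₀ → ∀ {c} → σ c ≡ c → c ≢ x₀ → ∀ m → T x₀ (p m) c
    T-fixed N order {c} σc≡c c≢x₀ = orbit-close
      where
      σ-fixedʳ : ∀ {x y} → T x y c → T (σ x) (σ y) c
      σ-fixedʳ t = subst (T _ _) σc≡c (T-σ t)

      σ-fixedᵐ : ∀ {x z} → T x c z → T (σ x) c (σ z)
      σ-fixedᵐ t = subst (λ c → T _ c _) σc≡c (T-σ t)

      descending : T (p 1) c x₀ → ∀ m → T (p (suc m)) c (p m)
      descending t zero    = t
      descending t (suc m) = σ-fixedᵐ (descending t m)

      descending′ : T (p 1) c x₀ → ∀ m → T (p (suc m)) c x₀
      descending′ t zero    = t
      descending′ t (suc m) = swap (T-trans (swap (descending t (suc m))) (swap (descending′ t m)))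

      ascending : T x₀ c (p 1) → ∀ m → T (p m) c (p (suc m))
      ascending t zero    = t
      ascending t (suc m) = σ-fixedᵐ (ascending t m)

      ascending′ : T x₀ c (p 1) → ∀ m → T x₀ c (p (suc m))
      ascending′ t zero    = t
      ascending′ t (suc m) = swap (T-trans (swap (ascending′ t m)) (swap (ascending t (suc m))))

      first : T x₀ (p 1) c
      first with binary x₀ (p 1) c
      ... | inj₁ t = t
      ... | inj₂ (inj₁ t) = ⊥-elim (T-irrefl (subst (λ x → T x c x₀) order (descending′ t N)))
      ... | inj₂ (inj₂ (inj₁ t)) = ⊥-elim (T-irrefl (subst (T x₀ c) order (ascending′ t N)))
      ... | inj₂ (inj₂ (inj₂ (_ , x₀≡c))) = ⊥-elim (c≢x₀ (sym x₀≡c))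

      consecutive : ∀ m → T (p m) (p (suc m)) c
      consecutive zero    = first
      consecutive (suc m) = σ-fixedʳ (consecutive m)

      orbit-close : ∀ m → T x₀ (p m) c
      orbit-close zero    = T-refl (c≢x₀ ∘ sym)
      orbit-close (suc m) = T-join (orbit-close m) (consecutive m)

    -- The distances between consecutive points cannot vary strictly
    -- monotonically along a finite orbit, so every other point is closer.
    module Alternation N (order : p (2 + N) ≡ x₀) (x₀≢σx₀ : x₀ ≢ σ x₀) where

      private
        ascending : T x₀ (p 1) (p 2) → ∀ m → T (p m) (p (1 + m)) (p (2 + m))
        ascending t zero    = t
        ascending t (suc m) = T-σ (ascending t m)

        ascending′ : T x₀ (p 1) (p 2) → ∀ m → T x₀ (p (1 + m)) (p (2 + m))
        ascending′ t zero    = t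
        ascending′ t (suc m) with split _ _ _ x₀ (ascending t (suc m))
        ... | inj₂ u = u
        ... | inj₁ u = ⊥-elim (asym _ _ _ (swap (ascending′ t m)) u)

        descending : T (p 1) (p 2) x₀ → ∀ m → T (p (1 + m)) (p (2 + m)) (p m)
        descending t zero    = t
        descending t (suc m) = T-σ (descending t m)

        descending′ : T (p 1) (p 2) x₀ → ∀ m → T (p (1 + m)) (p (2 + m)) x₀
        descending′ t zero    = t
        descending′ t (suc m) with split _ _ _ x₀ (swap (descending t (suc m)))
        ... | inj₁ u = swap u
        ... | inj₂ u = ⊥-elim (asym _ _ _ (swap (descending′ t m)) (swap u))

        alternate : T x₀ (p 2) (p 1)
        alternate with binary x₀ (p 1) (p 2)
        ... | inj₁ t = ⊥-elim (T-irrefl (subst (T x₀ (p (1 + N))) order (ascending′ t N)))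
        ... | inj₂ (inj₁ t) = ⊥-elim (T-irrefl
          (subst (λ x → T x (σ x) x₀) order (descending′ t (1 + N))))
        ... | inj₂ (inj₂ (inj₁ t)) = t
        ... | inj₂ (inj₂ (inj₂ (x₀≡p₁ , _))) = ⊥-elim (x₀≢σx₀ x₀≡p₁)

        even : ∀ m → T (q m) (q (suc m)) (σ (q m))
        even zero    = alternate
        even (suc m) = T-σ (T-σ (even m))

        -- `even c` moved by `σ` puts `σ (q c)` and `σ (q (suc c))` together against `q (suc c)`. If
        -- `σ (q (suc c))` were on the side of `x₀` and `w` against `σ (q c)`, it would by `u` also
        -- be joined there to `q (suc c)`, a contradiction.
        step : ∀ c {w} → T x₀ w (σ (q c)) → T x₀ (q (suc c)) (σ (q c)) → T x₀ w (σ (q (suc c)))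
        step c t u with split _ _ _ (σ (q (suc c))) t
        ... | inj₁ v = v
        ... | inj₂ v = ⊥-elim (asym _ _ _ (swap (T-σ (even c))) (T-join v (T-join (swap t) u)))

        diagonal : ∀ m → T x₀ (q m) (σ (q m))
        diagonal⁺ : ∀ m → T x₀ (q (suc m)) (σ (q m))
        diagonal zero    = T-refl x₀≢σx₀
        diagonal (suc m) = step m (diagonal⁺ m) (diagonal⁺ m)
        diagonal⁺ m = T-join (diagonal m) (even m)

      -- All even points of the orbit lie on one side and all odd points on the other. The odd index
      -- is at least the even one, which is no restriction on a cycle.
      T-alternate : ∀ m n → T x₀ (q m) (σ (q (n + m)))
      T-alternate m zero    = diagonal m
      T-alternate m (suc n) = step (n + m) (T-alternate m n) (diagonal⁺ (n + m))

  -- Induction on `k`: on the vectors with a given head, `σ ∘ σ` takes the place of `σ`. Triples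
  -- with mixed heads are settled by `Alternation`, because each step of `σ` flips the head.
  T-level : ∀ {k} (σ : X → X) → (∀ {x y z} → T x y z → T (σ x) (σ y) (σ z)) →
            (ι : Vec Bool k → X) → (∀ {v w} → ι v ≡ ι w → v ≡ w) →
            (∀ v → ι (odometer v) ≡ σ (ι v)) →
            ∀ u v w → T (ι u) (ι v) (ι w) ⟺ level u v < level u w
  T-level {zero} σ T-σ ι ι-inj ι-odometer [] [] [] = (⊥-elim ∘ T-irrefl) , λ ()
  T-level {suc k} σ T-σ ι ι-inj ι-odometer = cases
    where
    rec : ∀ b u v w → T (ι (b ∷ u)) (ι (b ∷ v)) (ι (b ∷ w)) ⟺ level u v < level u w
    rec b = T-level (σ ∘ σ) (T-σ ∘ T-σ) (ι ∘ (b ∷_)) (∷-injectiveʳ ∘ ι-inj)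
      λ v → trans (cong ι (sym (fold-odometer-∷ b v 1)))
            (trans (ι-odometer _) (cong σ (ι-odometer _)))

    ι-fold : ∀ v m → fold (ι v) σ m ≡ ι (fold v odometer m)
    ι-fold v zero    = refl
    ι-fold v (suc m) = trans (cong σ (ι-fold v m)) (sym (ι-odometer _))

    ι-fold² : ∀ b v m → fold (ι (b ∷ v)) (σ ∘ σ) m ≡ ι (b ∷ fold v odometer m)
    ι-fold² b v zero    = refl
    ι-fold² b v (suc m) = begin
      σ (σ (fold (ι (b ∷ v)) (σ ∘ σ) m)) ≡⟨ cong (σ ∘ σ) (ι-fold² b v m) ⟩
      σ (σ (ι (b ∷ w)))                  ≡⟨ cong σ (ι-odometer _) ⟨
      σ (ι (odometer (b ∷ w)))           ≡⟨ ι-odometer _ ⟨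
      ι (odometer (odometer (b ∷ w)))    ≡⟨ cong ι (fold-odometer-∷ b w 1) ⟩
      ι (b ∷ odometer w)                 ∎
      where
      open ≡-Reasoning
      w = fold v odometer m

    odometer≢ : ∀ b (v : Vec Bool k) → b ∷ v ≢ odometer (b ∷ v)
    odometer≢ false v ()
    odometer≢ true  v ()

    across : ∀ b u v w → T (ι (b ∷ u)) (ι (b ∷ v)) (ι (odometer (b ∷ w)))
    across b u v w with n , 2^k≡ ← 2^-positive k
      with m , refl ← odometer-reaches u v | l , refl ← odometer-reaches v w =
      subst₂ (T (ι (b ∷ u))) (ι-fold² b u m)
        (trans (cong σ (trans (ι-fold² b u (l + m)) (cong (ι ∘ (b ∷_)) (fold-+ u odometer l))))
          (sym (ι-odometer _)))
        (T-alternate m l)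
      where
      open Orbit σ T-σ (ι (b ∷ u))
      2^1+k≡ : 2 ^ suc k ≡ 2 + (n + n)
      2^1+k≡ rewrite +-identityʳ (2 ^ k) | 2^k≡ = cong suc (+-suc n n)
      open Alternation (n + n)
        (trans (ι-fold (b ∷ u) (2 + (n + n))) (cong ι
          (trans (cong (fold (b ∷ u) odometer) (sym 2^1+k≡)) (odometer-order (suc k) (b ∷ u)))))
        (λ eq → odometer≢ b u (ι-inj (trans eq (sym (ι-odometer _)))))

    ft : ∀ u v w → T (ι (false ∷ u)) (ι (false ∷ v)) (ι (true ∷ w))
    ft = across false
    tf : ∀ u v w → T (ι (true ∷ u)) (ι (true ∷ v)) (ι (false ∷ w))
    tf u v w with w′ , refl ← odometer-surjective w = across true u v w′

    cases : ∀ u v w → T (ι u) (ι v) (ι w) ⟺ level u v < level u w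
    cases (false ∷ u) (false ∷ v) (false ∷ w) = rec false u v w
    cases (true  ∷ u) (true  ∷ v) (true  ∷ w) = rec true u v w
    cases (false ∷ u) (false ∷ v) (true  ∷ w) = (λ _ → s≤s (level-≤ u v)) , λ _ → ft u v w
    cases (true  ∷ u) (true  ∷ v) (false ∷ w) = (λ _ → s≤s (level-≤ u v)) , λ _ → tf u v w
    cases (false ∷ u) (true  ∷ v) (false ∷ w) =
      (λ t → ⊥-elim (asym _ _ _ t (ft u w v))) ,
      λ p → ⊥-elim (<⇒≱ p (m≤n⇒m≤1+n (level-≤ u w)))
    cases (true  ∷ u) (false ∷ v) (true  ∷ w) =
      (λ t → ⊥-elim (asym _ _ _ t (tf u w v))) ,
      λ p → ⊥-elim (<⇒≱ p (m≤n⇒m≤1+n (level-≤ u w)))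
    cases (false ∷ u) (true  ∷ v) (true  ∷ w) =
      (λ t → ⊥-elim (asym _ _ _ (swap t) (tf v w u))) , λ p → ⊥-elim (<-irrefl refl p)
    cases (true  ∷ u) (false ∷ v) (false ∷ w) =
      (λ t → ⊥-elim (asym _ _ _ (swap t) (ft v w u))) , λ p → ⊥-elim (<-irrefl refl p)

-- The standard model

⟺-trans : ∀ {A B C} → A ⟺ B → B ⟺ C → A ⟺ C
⟺-trans (f , f′) (g , g′) = g ∘ f , f′ ∘ g′

⟺-sym : ∀ {A B} → A ⟺ B → B ⟺ A
⟺-sym = swap

PowerOf2 : ℕ → Set
PowerOf2 n = ∃[ m ] 2 ^ m ≡ n

≡-PowerOf2 : ∀ {m n} → m ≡ n → PowerOf2 m ⟺ PowerOf2 n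
≡-PowerOf2 refl = id , id

n<2^n : ∀ n → n < 2 ^ n
n<2^n zero    = s≤s z≤n
n<2^n (suc n) = subst (_≤ 2 ^ suc n) (+-comm (suc n) 1)
  (+-mono-≤ (n<2^n n) (subst (1 ≤_) (sym (+-identityʳ (2 ^ n))) (m^n>0 2 n)))

double : ∀ n → n + n ≡ 2 * n
double n = cong (λ m → n + m) (sym (+-identityʳ n))

PowerOf2-double : ∀ n → PowerOf2 (n + n) ⟺ PowerOf2 n
PowerOf2-double n = to , λ (m , eq) → suc m , trans (cong (2 *_) eq) (sym (double n))
  where
  to : PowerOf2 (n + n) → PowerOf2 n
  to (suc m , eq) = m , *-cancelˡ-≡ (2 ^ m) n 2 (trans eq (double n))
  to (zero , eq) = ⊥-elim (even≢odd n 0 (trans (sym (double n)) (sym eq)))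

PowerOf2-odd : ∀ n → PowerOf2 (n + suc n) ⟺ n ≡ 0
PowerOf2-odd n = to n , λ { refl → 0 , refl }
  where
  to : ∀ n → PowerOf2 (n + suc n) → n ≡ 0
  to zero _ = refl
  to (suc n) (zero , eq) with () ← trans eq (cong suc (+-suc n (suc n)))
  to n (suc m , eq) =
    ⊥-elim (even≢odd (2 ^ m) n (trans eq (trans (+-suc n n) (cong suc (double n)))))

-- The sum lies strictly between the consecutive powers 2 ^ e and 2 ^ (e + 1).
¬PowerOf2-between : ∀ e {i} → 0 < i → i < 2 ^ e → ¬ PowerOf2 (i + 2 ^ e)
¬PowerOf2-between e {i} 0<i i<2^e (m , eq) with m ≤? e
... | yes m≤e = <⇒≱ (subst (2 ^ e <_) (trans (+-comm (2 ^ e) i) (sym eq)) (m<m+n (2 ^ e) 0<i))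
                    (^-monoʳ-≤ 2 m≤e)
... | no m≰e = <⇒≱ (subst₂ _<_ (sym eq) (double (2 ^ e)) (+-monoˡ-< (2 ^ e) i<2^e))
                   (^-monoʳ-≤ 2 (≰⇒> m≰e))

-- The first disjunct encodes the rooted triple vw|u. The second stores f(i, i') at a triple uv|w,
-- with i and i' the levels of `v` and `w` seen from `u`.
Std : ∀ {k} → Vec Bool k → Vec Bool k → Vec Bool k → Set
Std u v w = level v w < level u v ⊎
            (level u v < level u w × PowerOf2 (level u v + level u w))

module _ {X : Set} {r : X → X → X → Set} {k : ℕ} (to : X → Vec Bool k)
  (to-injective : ∀ {x y} → to x ≡ to y → x ≡ y) (to-surjective : ∀ v → ∃[ x ] to x ≡ v)
  (r-std : ∀ x y z → r x y z ⟺ Std (to x) (to y) (to z)) where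

  private
    δ : X → X → ℕ
    δ x y = level (to x) (to y)

    δ-sym : ∀ x y → δ x y ≡ δ y x
    δ-sym x y = level-sym (to x) (to y)

    δ-ultra : ∀ {x y z} → δ x y < δ x z → δ x z ≡ δ y z
    δ-ultra = level-ultra (to _) (to _) (to _)

    δ-surjective : ∀ x {i} → i ≤ k → ∃[ y ] δ x y ≡ i
    δ-surjective x i≤k with v , refl ← level-surjective (to x) i≤k
      with y , refl ← to-surjective v = y , refl

    close : ∀ {x y z} → δ x y < δ x z → Closer r x y z
    close {x} {y} {z} p =
      proj₂ (r-std z x y) (inj₁ (subst (δ x y <_) (δ-sym x z) p)) ,
      proj₂ (r-std z y x) (inj₁ (subst₂ _<_ (δ-sym x y) (trans (δ-ultra p) (δ-sym y z)) p))

    -- The stored bits create no spurious closeness: if `r z x y` held as a bit, then d(z,x) <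
    -- d(z,y) = d(x,y), and `r z y x` would fail.
    close⁻ : ∀ {x y z} → Closer r x y z → δ x y < δ x z
    close⁻ {x} {y} {z} (zxy , zyx) with proj₁ (r-std z x y) zxy | proj₁ (r-std z y x) zyx
    ... | inj₁ p       | _            = subst (δ x y <_) (δ-sym z x) p
    ... | inj₂ (p , _) | inj₂ (q , _) = ⊥-elim (<-asym p q)
    ... | inj₂ (p , _) | inj₁ q       = ⊥-elim (<-irrefl (trans (δ-sym y x) (sym (δ-ultra p))) q)

    bit : ∀ {x y z} → δ x y < δ x z → r x y z ⟺ PowerOf2 (δ x y + δ x z)
    bit {x} {y} {z} p = fwd , λ pow → proj₂ (r-std x y z) (inj₂ (p , pow))
      where
      fwd : r x y z → PowerOf2 (δ x y + δ x z)
      fwd xyz with proj₁ (r-std x y z) xyz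
      ... | inj₂ (_ , pow) = pow
      ... | inj₁ q = ⊥-elim (<-asym p (subst (_< δ x y) (sym (δ-ultra p)) q))

    bit-at : ∀ {x y z n} → δ x y < δ x z → δ x y + δ x z ≡ n → r x y z ⟺ PowerOf2 n
    bit-at p refl = bit p

    next⁻ : ∀ {x y z} → Next r x y z → δ x z ≡ suc (δ x y)
    next⁻ {x} {y} {z} (t , none) with <-cmp (suc (δ x y)) (δ x z)
    ... | tri≈ _ eq _ = sym eq
    ... | tri> _ _ gt = ⊥-elim (<⇒≱ gt (close⁻ t))
    ... | tri< lt _ _ with w , eq ← δ-surjective x (≤-trans (<⇒≤ lt) (level-≤ (to x) (to z))) =
      ⊥-elim (none (w , close (≤-reflexive (sym eq)) , close (subst (_< δ x z) (sym eq) lt)))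

    next⁺ : ∀ {x y z} → δ x z ≡ suc (δ x y) → Next r x y z
    next⁺ eq = close (≤-reflexive (sym eq)) ,
      λ (w , xy|w , xw|z) → <⇒≱ (<-≤-trans (s≤s (close⁻ xy|w)) (close⁻ xw|z)) (≤-reflexive eq)

    δ-split : ∀ {x y z w} → δ x y < δ x z → ¬ (δ x y < δ x w) → δ w y < δ w z
    δ-split {x} {y} {z} {w} p q = subst (δ w y <_) (δ-ultra (≤-<-trans (≮⇒≥ q) p)) wy<xz
      where
      wy<xz : δ w y < δ x z
      wy<xz with <-cmp (δ x w) (δ x y)
      ... | tri> _ _ gt = ⊥-elim (q gt)
      ... | tri< lt _ _ = subst (_< δ x z) (δ-ultra lt) p
      ... | tri≈ _ xw≡xy _ with <-cmp (δ x y) (δ w y)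
      ...   | tri≈ _ eq _ = subst (_< δ x z) eq p
      ...   | tri> _ _ gt = <-trans gt p
      ...   | tri< lt _ _ = ⊥-elim (<-irrefl (sym (begin
        δ w y ≡⟨ δ-sym w y ⟩
        δ y w ≡⟨ δ-ultra (subst₂ _<_ (δ-sym x y) (δ-sym w y) lt) ⟩
        δ x w ≡⟨ xw≡xy ⟩
        δ x y ∎)) lt)
        where open ≡-Reasoning

  -- The rules become arithmetic of i + i': for `diag` the sum 2i + 1 is odd, hence a power of 2
  -- only if i = 0; for `halve` it is 2(i + 1); `shift` preserves it. All leaves have depth `k`, so
  -- `top` asks that `k` be a power of 2.
  Std-model : PowerOf2 k → Model r
  Std-model (e , 2^e≡k) = record
    { asym   = λ x y z t u → <-asym (close⁻ t) (close⁻ u)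
    ; split  = λ x y z w t → split′ (close⁻ t)
    ; binary = λ x y z → binary′ x y z (level-binary (to x) (to y) (to z))
    ; tight  = tight′
    ; diag   = λ x y z n → let eq = next⁻ n in
        ⟺-trans (bit-at (≤-reflexive (sym eq)) (cong (λ m → δ x y + m) eq))
          (⟺-trans (PowerOf2-odd (δ x y))
            (to-injective ∘ level≡0 (to x) (to y) , λ { refl → level-refl (to x) }))
    ; halve  = λ x y y′ z (m , n) → let p = next⁻ m ; q = trans (next⁻ n) (cong suc p) in
        ⟺-trans (bit-at (subst (δ x y <_) (sym q) (s≤s (n≤1+n _)))
                  (trans (cong (λ m → δ x y + m) q) (+-suc (δ x y) (suc (δ x y)))))
          (⟺-trans (PowerOf2-double (suc (δ x y)))
            (⟺-sym (bit-at (subst₂ _<_ (sym (level-refl (to x))) (sym p) (s≤s z≤n))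
                     (cong₂ _+_ (level-refl (to x)) p))))
    ; shift  = λ x y y′ z z′ (m , n , t) → let p = next⁻ m ; q = next⁻ n in
        ⟺-trans (bit-at (<-trans (subst (δ x y <_) (sym p) ≤-refl)
                          (<-trans (close⁻ t) (subst (δ x z <_) (sym q) ≤-refl)))
                  (trans (cong (λ m → δ x y + m) q) (+-suc (δ x y) (δ x z))))
          (⟺-sym (bit-at (close⁻ t) (cong (_+ δ x z) p)))
    ; next   = λ x z w t →
        let w′ , eq = δ-surjective x (≤-trans (close⁻ t) (level-≤ (to x) (to w))) in
        w′ , next⁺ eq
    ; top    = top′
    }
    where
    split′ : ∀ {x y z w} → δ x y < δ x z → Closer r x y w ⊎ Closer r w y z
    split′ {x} {y} {z} {w} p with δ x y <? δ x w
    ... | yes q = inj₁ (close q)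
    ... | no q  = inj₂ (close (δ-split {x} {y} {z} {w} p q))

    binary′ : ∀ x y z →
      δ x y < δ x z ⊎ δ y z < δ y x ⊎ δ x z < δ x y ⊎ (to x ≡ to y × to x ≡ to z) →
      Closer r x y z ⊎ Closer r y z x ⊎ Closer r x z y ⊎ (x ≡ y × x ≡ z)
    binary′ x y z (inj₁ p) = inj₁ (close p)
    binary′ x y z (inj₂ (inj₁ p)) = inj₂ (inj₁ (close p))
    binary′ x y z (inj₂ (inj₂ (inj₁ p))) = inj₂ (inj₂ (inj₁ (close p)))
    binary′ x y z (inj₂ (inj₂ (inj₂ (p , q)))) =
      inj₂ (inj₂ (inj₂ (to-injective p , to-injective q)))

    tight′ : ∀ x y z → r x y z → r x z y ⊎ Closer r x y z
    tight′ x y z xyz with proj₁ (r-std x y z) xyz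
    ... | inj₁ p       = inj₁ (proj₂ (close (subst (δ y z <_) (δ-sym x y) p)))
    ... | inj₂ (p , _) = inj₂ (close p)

    top′ : ∀ x z → ¬ (∃[ w ] Closer r x z w) → r x x z
    top′ x z none with δ x z ≟ k
    ... | yes eq = proj₂ (bit-at (subst₂ _<_ (sym (level-refl (to x))) (sym eq)
                                   (subst (0 <_) 2^e≡k (m^n>0 2 e)))
                                 (cong₂ _+_ (level-refl (to x)) eq)) (e , 2^e≡k)
    ... | no neq with w , eq ← δ-surjective x ≤-refl =
      ⊥-elim (none (w , close (subst (δ x z <_) (sym eq) (≤∧≢⇒< (level-≤ (to x) (to z)) neq))))

-- Models whose tree contains a complete binary subtree

module Embedded {X : Set} {r : X → X → X → Set} (model : Model r) {k j : ℕ}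
  (ι : Vec Bool k → X) (ι-injective : ∀ {u v} → ι u ≡ ι v → u ≡ v) (κ : Fin j → X)
  (cover : ∀ x → (∃[ v ] ι v ≡ x) ⊎ (∃[ i ] κ i ≡ x))
  (closer-level : ∀ u v w → Closer r (ι u) (ι v) (ι w) ⟺ level u v < level u w)
  (closer-κ : ∀ u v i → Closer r (ι u) (ι v) (κ i)) where
  open Model model
  open Tree model

  -- The outer points `κ i` are farther from `ι u` than every point of the subtree, so none of them
  -- comes between.
  next-level : ∀ {u v w} → level u w ≡ suc (level u v) → Next r (ι u) (ι v) (ι w)
  next-level {u} {v} {w} eq =
    proj₂ (closer-level u v w) (≤-reflexive (sym eq)) ,
    λ (x , below , above) → between x below above
    where
    between : ∀ x → T (ι u) (ι v) x → ¬ T (ι u) x (ι w)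
    between x below above with cover x
    ... | inj₂ (i , refl) = asym _ _ _ above (closer-κ u w i)
    ... | inj₁ (x , refl) = <⇒≱ (<-≤-trans (s≤s (proj₁ (closer-level u v x) below))
                                           (proj₁ (closer-level u x w) above)) (≤-reflexive eq)

  -- Induction on the upper level. A gap of 1 is settled by `diag`; `halve` for a gap of 2 and
  -- `shift` for a larger gap both reduce to upper level `n`.
  bit : ∀ n u v w → level u w ≡ n → level u v < n →
        r (ι u) (ι v) (ι w) ⟺ PowerOf2 (level u v + n)
  bit (suc n) u v w uw≡ (s≤s uv≤n) with <-cmp (suc (level u v)) n
  ... | tri> _ _ gt with uv≡n ← ≤-antisym uv≤n (≤-pred gt) =
    ⟺-trans (diag _ _ _ (next-level (trans uw≡ (cong suc (sym uv≡n)))))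
      (⟺-trans ((λ eq → trans (cong (level u) (sym (ι-injective eq))) (level-refl u)) ,
                 (λ eq → cong ι (level≡0 u v eq)))
        (⟺-trans (⟺-sym (PowerOf2-odd (level u v)))
          (≡-PowerOf2 (cong (λ m → level u v + suc m) uv≡n))))
  ... | tri≈ _ eq _
    with v′ , uv′≡ ← level-surjective u (≤-trans (n≤1+n n) (subst (_≤ k) uw≡ (level-≤ u w))) =
    ⟺-trans (halve _ _ _ _
        (next-level (trans uv′≡ (sym eq)) , next-level (trans uw≡ (cong suc (sym uv′≡)))))
      (⟺-trans (bit n u u v′ uv′≡ (subst₂ _<_ (sym (level-refl u)) eq (s≤s z≤n)))
        (⟺-trans (≡-PowerOf2 (cong (_+ n) (level-refl u)))
          (⟺-trans (⟺-sym (PowerOf2-double n))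
            (≡-PowerOf2 (trans (cong (_+ n) (sym eq)) (sym (+-suc (level u v) n)))))))
  ... | tri< lt _ _
    with n≤k ← ≤-trans (n≤1+n n) (subst (_≤ k) uw≡ (level-≤ u w))
    with v′ , uv′≡ ← level-surjective u (≤-trans (<⇒≤ lt) n≤k)
       | w′ , uw′≡ ← level-surjective u n≤k =
    ⟺-trans (shift _ _ _ _ _
        ( next-level uv′≡ , next-level (trans uw≡ (cong suc (sym uw′≡)))
        , proj₂ (closer-level u v′ w′) (subst₂ _<_ (sym uv′≡) (sym uw′≡) lt)))
      (⟺-trans (bit n u v′ w′ uw′≡ (subst (_< n) (sym uv′≡) lt))
        (≡-PowerOf2 (trans (cong (_+ n) uv′≡) (sym (+-suc (level u v) n)))))

  bit-level : ∀ {u v w} → level u v < level u w →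
              r (ι u) (ι v) (ι w) ⟺ PowerOf2 (level u v + level u w)
  bit-level {u} {v} {w} = bit (level u w) u v w refl

  -- If `u`, `v` are the close pair, the triple is a bit; if `v`, `w` are, it encodes closeness. In
  -- the remaining cases `tight` leaves no freedom, so `r` is determined on the subtree.
  standard : ∀ u v w → r (ι u) (ι v) (ι w) ⟺ Std u v w
  standard u v w = to , from
    where
    to : r (ι u) (ι v) (ι w) → Std u v w
    to ruvw with level-binary u v w
    ... | inj₁ p = inj₂ (p , proj₁ (bit-level p) ruvw)
    ... | inj₂ (inj₁ p) = inj₁ (subst (level v w <_) (level-sym v u) p)
    ... | inj₂ (inj₂ (inj₂ (refl , refl))) with tight _ _ _ ruvw
    ...   | inj₁ t = ⊥-elim (T-irrefl (t , t))
    ...   | inj₂ t = ⊥-elim (T-irrefl t)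
    to ruvw | inj₂ (inj₂ (inj₁ p)) with tight _ _ _ ruvw
    ...   | inj₁ ruwv =
      inj₁ (subst (level v w <_) (level-sym v u) (proj₁ (closer-level v w u) (ruvw , ruwv)))
    ...   | inj₂ t    = ⊥-elim (asym _ _ _ t (proj₂ (closer-level u w v) p))

    from : Std u v w → r (ι u) (ι v) (ι w)
    from (inj₁ p) = proj₁ (proj₂ (closer-level v w u) (subst (level v w <_) (level-sym u v) p))
    from (inj₂ (p , pow)) = proj₂ (bit-level p) pow

  -- From u one climbs through the levels k + e above the subtree.  By shift,
  -- f(i, k + e) agrees with f(i + e, k), which is false for 0 < i + e < k; for
  -- i = 0 this contradicts top once the climb ends, which it does with e ≤ j.
  module _ (e₀ : ℕ) (2^e₀≡k : 2 ^ e₀ ≡ k) (j<k : j < k) (i₀ : Fin j) (u : Vec Bool k) where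

    record Climb (e : ℕ) (z : X) : Set where
      field
        above         : ∀ v → level u v < k → T (ι u) (ι v) z
        highest       : ∀ v → ¬ T (ι u) z (ι v)
        -- `z` is at level k + e, so this says that f(i, k + e) fails for 0 < i + e < k.
        bits          : ∀ v → 0 < level u v + e → level u v + e < k → ¬ r (ι u) (ι v) z
        -- At e = 0 the bit f(0, k) is true and `top` gives no contradiction; there an outer point
        -- keeps the climb from ending.
        unfinished    : e ≡ 0 → ∃[ w ] T (ι u) z w
        -- The outer points passed so far, the highest first.
        below         : Fin e → Fin j
        below-ascends : ∀ a b → a Fin.< b → T (ι u) (κ (below b)) (κ (below a))
        below-closer  : ∀ a w → T (ι u) z w → T (ι u) (κ (below a)) w

    climb-start : ∀ w → level u w ≡ k → Climb 0 (ι w)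
    climb-start w uw≡k = record
      { above         = λ v uv<k →
          proj₂ (closer-level u v w) (subst (level u v <_) (sym uw≡k) uv<k)
      ; highest       = λ v t →
          <⇒≱ (subst (_< level u v) uw≡k (proj₁ (closer-level u w v) t)) (level-≤ u v)
      ; bits          = λ v 0<uv uv<k ruvw → ¬PowerOf2-between e₀
          (subst (0 <_) (+-identityʳ _) 0<uv)
          (subst₂ _<_ (+-identityʳ _) (sym 2^e₀≡k) uv<k)
          (proj₁ (≡-PowerOf2 (cong (λ m → level u v + m) (trans uw≡k (sym 2^e₀≡k))))
            (proj₁ (bit-level (subst₂ _<_ (+-identityʳ _) (sym uw≡k) uv<k)) ruvw))
      ; unfinished    = λ _ → κ i₀ , closer-κ u w i₀
      ; below         = λ ()
      ; below-ascends = λ ()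
      ; below-closer  = λ ()
      }

    climb-step : ∀ {e z} → Climb e z → ∀ i → Next r (ι u) z (κ i) → Climb (suc e) (κ i)
    climb-step {e} {z} climb i z→κi = record
      { above         = λ v _ → closer-κ u v i
      ; highest       = λ v t → asym _ _ _ t (closer-κ u v i)
      ; bits          = bits′
      ; unfinished    = λ ()
      ; below         = below′
      ; below-ascends = ascends
      ; below-closer  = closer
      }
      where
      open Climb climb
      bits′ : ∀ v → 0 < level u v + suc e → level u v + suc e < k → ¬ r (ι u) (ι v) (κ i)
      bits′ v _ lt ruvκ
        with lt′ ← subst (_< k) (+-suc (level u v) e) lt
        with 1+uv<k ← ≤-<-trans (m≤m+n (suc (level u v)) e) lt′
        with v′ , uv′≡ ← level-surjective u (<⇒≤ 1+uv<k) =
        bits v′ (subst (λ l → 0 < l + e) (sym uv′≡) (s≤s z≤n))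
          (subst (λ l → l + e < k) (sym uv′≡) lt′)
          (proj₁ (shift _ _ _ _ _
            (next-level uv′≡ , z→κi , above v′ (subst (_< k) (sym uv′≡) 1+uv<k))) ruvκ)
      below′ : Fin (suc e) → Fin j
      below′ zero    = i
      below′ (suc a) = below a
      ascends : ∀ a b → a Fin.< b → T (ι u) (κ (below′ b)) (κ (below′ a))
      ascends zero (suc b) _ = below-closer b _ (proj₁ z→κi)
      ascends (suc a) (suc b) (s≤s a<b) = below-ascends a b a<b
      closer : ∀ a w → T (ι u) (κ i) w → T (ι u) (κ (below′ a)) w
      closer zero    w t = t
      closer (suc a) w t = below-closer a w (T-trans (proj₁ z→κi) t)

    -- A step upwards always lands on an outer point, since `highest` excludes the subtree. When
    -- `fuel` is used up, `suc j` strictly ascending outer points have been passed, against the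
    -- pigeonhole principle.
    climb-end : ∀ fuel e z → e + fuel ≡ suc j → ¬ Climb e z
    climb-end zero e z eq climb
      with a , b , a<b , same ←
             pigeonhole (≤-reflexive (trans (sym eq) (+-identityʳ e))) (Climb.below climb) =
      T-irreflˡ (subst (λ c → T (ι u) (κ c) (κ (below a))) (sym same) (below-ascends a b a<b))
      where open Climb climb
    climb-end (suc fuel) e z eq climb = not-top e climb e≤j higher
      where
      eq′ : suc e + fuel ≡ suc j
      eq′ = trans (sym (+-suc e fuel)) eq

      e≤j : e ≤ j
      e≤j = ≤-pred (subst (suc e ≤_) eq′ (m≤m+n (suc e) fuel))

      higher : ¬ (∃[ w ] T (ι u) z w)
      higher (w , t) with w′ , z→w′ ← next _ _ _ t with cover w′
      ... | inj₁ (v , refl) = Climb.highest climb v (proj₁ z→w′)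
      ... | inj₂ (i , refl) = climb-end fuel (suc e) (κ i) eq′ (climb-step climb i z→w′)

      not-top : ∀ e → Climb e z → e ≤ j → ¬ ¬ (∃[ w ] T (ι u) z w)
      not-top zero climb _ none = none (Climb.unfinished climb refl)
      -- Seen from `u`, the point `u` has level 0, so `top` would make f(0, k + suc e) true; `bits`
      -- denies it because 0 < suc e ≤ j < k.
      not-top (suc e) climb e≤j none = Climb.bits climb u
        (subst (λ l → 0 < l + suc e) (sym (level-refl u)) (s≤s z≤n))
        (subst (λ l → l + suc e < k) (sym (level-refl u)) (≤-<-trans e≤j j<k))
        (top _ _ none)

    no-outer-points : ⊥
    no-outer-points with w , uw≡k ← level-surjective u ≤-refl =
      climb-end (suc j) 0 (ι w) refl (climb-start w uw≡k)

-- Models on 2 ^ k + j points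

Vec↔Fin : ∀ k → Vec Bool k ↔ Fin (2 ^ k)
Vec↔Fin zero    = mk↔ₛ′ (λ _ → zero) (λ _ → []) (λ { zero → refl }) (λ { [] → refl })
Vec↔Fin (suc k) = ↔-trans
  (mk↔ₛ′ uncons (uncurry _∷_) (λ _ → refl) (λ { (_ ∷ _) → refl }))
  (↔-trans (↔-sym 2↔Bool ×-↔ Vec↔Fin k) (↔-sym *↔×))

universe : ∀ k j → (Vec Bool k ⊎ Fin j) ↔ Fin (2 ^ k + j)
universe k j = ↔-trans (Vec↔Fin k ⊎-↔ ↔-refl) (↔-sym +↔⊎)

_≟ʳ_ : ∀ {n} → DecidableEquality (TernaryRelation n)
_≟ʳ_ = ≡-dec (≡-dec (≡-dec Bool._≟_))

module Rotation (k j : ℕ) where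

  open Inverse (universe k j) renaming
    ( to to encode; from to decode
    ; strictlyInverseˡ to encode-decode; strictlyInverseʳ to decode-encode)

  private
    X = Fin (2 ^ k + j)

  encode-injective : ∀ {u v} → encode u ≡ encode v → u ≡ v
  encode-injective {u} {v} eq =
    trans (sym (decode-encode u)) (trans (cong decode eq) (decode-encode v))

  decode-injective : ∀ {u v} → decode u ≡ decode v → u ≡ v
  decode-injective {u} {v} eq =
    trans (sym (encode-decode u)) (trans (cong encode eq) (encode-decode v))

  ι : Vec Bool k → X
  ι = encode ∘ inj₁

  κ : Fin j → X
  κ = encode ∘ inj₂

  cover : ∀ x → (∃[ v ] ι v ≡ x) ⊎ (∃[ i ] κ i ≡ x)
  cover x with decode x in eq
  ... | inj₁ v = inj₁ (v , trans (cong encode (sym eq)) (encode-decode x))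
  ... | inj₂ i = inj₂ (i , trans (cong encode (sym eq)) (encode-decode x))

  σ : X → X
  σ = encode ∘ ⊎.map odometer id ∘ decode

  σ-ι : ∀ v → σ (ι v) ≡ ι (odometer v)
  σ-ι v = cong (encode ∘ ⊎.map odometer id) (decode-encode (inj₁ v))

  σ-κ : ∀ i → σ (κ i) ≡ κ i
  σ-κ i = cong (encode ∘ ⊎.map odometer id) (decode-encode (inj₂ i))

  fold-ι : ∀ v m → fold (ι v) σ m ≡ ι (fold v odometer m)
  fold-ι v zero    = refl
  fold-ι v (suc m) = trans (cong σ (fold-ι v m)) (σ-ι _)

  fold-κ : ∀ i m → fold (κ i) σ m ≡ κ i
  fold-κ i zero    = refl
  fold-κ i (suc m) = trans (cong σ (fold-κ i m)) (σ-κ i)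

  σ-order : ∀ x → fold x σ (2 ^ k) ≡ x
  σ-order x with cover x
  ... | inj₁ (v , refl) = trans (fold-ι v (2 ^ k)) (cong ι (odometer-order k v))
  ... | inj₂ (i , refl) = fold-κ i (2 ^ k)

  σ-injective : ∀ {x y} → σ x ≡ σ y → x ≡ y
  σ-injective = decode-injective ∘ map-injective ∘ encode-injective
    where
    map-injective : ∀ {u v : Vec Bool k ⊎ Fin j} →
                    ⊎.map odometer id u ≡ ⊎.map odometer id v → u ≡ v
    map-injective {inj₁ u} {inj₁ v} eq = cong inj₁ (odometer-injective (inj₁-injective eq))
    map-injective {inj₂ i} {inj₂ .i} refl = refl

  σ-surjective : ∀ y → ∃[ x ] σ x ≡ y
  σ-surjective y with cover y
  ... | inj₂ (i , refl) = κ i , σ-κ i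
  ... | inj₁ (v , refl) with w , refl ← odometer-surjective v = ι w , σ-ι w

  Invariant : TernaryRelation (2 ^ k + j) → Set
  Invariant A = pullback σ A ≡ A

  invariantModel? : (A : TernaryRelation (2 ^ k + j)) → Dec ((A ⊨ treeSentence) × Invariant A)
  invariantModel? A = sat? A [] treeSentence ×-dec fixed? _≟ʳ_ (pullback σ) A

  -- `pullback σ` maps models to models, and its 2 ^ k-th iterate is the identity.
  Sp-parity : parity (Sp treeSentence (2 ^ k + j)) ≡
              parity (length (filter invariantModel? (allRelations (2 ^ k + j))))
  Sp-parity = cyclic-parity _≟ʳ_ (allRelations-unique _) allRelations-complete k (pullback σ)
    (λ A → sat? A [] treeSentence)
    (λ {A} A⊨ → proj₂ (pullback-⊨ σ σ-injective σ-surjective A [] treeSentence) A⊨)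
    (λ {A} _ → holds-injective λ x y z → trans (holds-fold-pullback σ A (2 ^ k) x y z)
      (trans (cong (λ w → holds A w _ _) (σ-order x)) (cong₂ (holds A x) (σ-order y) (σ-order z))))

  module InvariantModel {A : TernaryRelation (2 ^ k + j)} (A⊨ : A ⊨ treeSentence)
                        (invariant : Invariant A) where
    model = ⊨⇒Model A A⊨
    open Tree model

    Holds-σ : ∀ {x y z} → Holds A x y z → Holds A (σ x) (σ y) (σ z)
    Holds-σ {x} {y} {z} h = proj₁ (pullback-∈ σ σ-injective σ-surjective A)
      (subst (λ B → Holds B x y z) (sym invariant) h)

    T-σ : ∀ {x y z} → T x y z → T (σ x) (σ y) (σ z)
    T-σ (s , t) = Holds-σ s , Holds-σ t

    T-κ : ∀ u v i → T (ι u) (ι v) (κ i)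
    T-κ u v i with n , 2^k≡ ← 2^-positive k | m , refl ← odometer-reaches u v =
      subst (λ x → T (ι u) x (κ i)) (fold-ι u m)
        (Orbit.T-fixed σ T-σ (ι u) n (trans (cong (fold (ι u) σ) (sym 2^k≡)) (σ-order (ι u)))
          (σ-κ i) (λ eq → κ≢ι (encode-injective eq)) m)
      where
      κ≢ι : ∀ {i : Fin j} {u : Vec Bool k} → inj₂ i ≢ inj₁ u
      κ≢ι ()

    open Embedded model ι (inj₁-injective ∘ encode-injective) κ cover
      (T-level σ T-σ ι (inj₁-injective ∘ encode-injective) (sym ∘ σ-ι)) T-κ public

  even-Sp : ∀ e → 2 ^ e ≡ k → 0 < j → j < k → parity (Sp treeSentence (2 ^ k + j)) ≡ 0ℙ
  even-Sp e 2^e≡k 0<j j<k = trans Sp-parity (cong (parity ∘ length)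
    (filter-none invariantModel? (All.universal
      (λ A (A⊨ , invariant) → InvariantModel.no-outer-points A⊨ invariant e 2^e≡k j<k
        (Fin.fromℕ< 0<j) (replicate k false))
      (allRelations (2 ^ k + j)))))

PowerOf2? : ∀ n → Dec (PowerOf2 n)
PowerOf2? n = map′ (λ (m , _ , eq) → m , eq) (λ (m , eq) → m , subst (m <_) eq (n<2^n m) , eq)
  (anyUpTo? (λ m → 2 ^ m ≟ n) n)

Std? : ∀ {k} (u v w : Vec Bool k) → Dec (Std u v w)
Std? u v w = level v w <? level u v ⊎-dec
  (level u v <? level u w ×-dec PowerOf2? (level u v + level u w))

module _ (k : ℕ) where

  open Rotation k 0
  private
    X = Fin (2 ^ k + 0)

    vec : X → Vec Bool k
    vec x with cover x
    ... | inj₁ (v , _) = v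

    ι-vec : ∀ x → ι (vec x) ≡ x
    ι-vec x with cover x
    ... | inj₁ (_ , eq) = eq

    vec-ι : ∀ v → vec (ι v) ≡ v
    vec-ι v = inj₁-injective (encode-injective (ι-vec (ι v)))

    vec-injective : ∀ {x y} → vec x ≡ vec y → x ≡ y
    vec-injective {x} {y} eq = trans (sym (ι-vec x)) (trans (cong ι eq) (ι-vec y))

    vec-σ : ∀ x → vec (σ x) ≡ odometer (vec x)
    vec-σ x = trans (cong (vec ∘ σ) (sym (ι-vec x))) (trans (cong vec (σ-ι (vec x))) (vec-ι _))

  stdRelation : TernaryRelation (2 ^ k + 0)
  stdRelation = relation λ x y z → does (Std? (vec x) (vec y) (vec z))

  Holds-stdRelation : ∀ x y z → Holds stdRelation x y z ⟺ Std (vec x) (vec y) (vec z)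
  Holds-stdRelation x y z =
    (λ h → does-true (Std? (vec x) (vec y) (vec z))
      (trans (sym (holds-relation _ x y z)) (∈⇒holds stdRelation h))) ,
    (λ s → holds⇒∈ stdRelation
      (trans (holds-relation _ x y z) (dec-true (Std? (vec x) (vec y) (vec z)) s)))
    where
    does-true : ∀ {P : Set} (P? : Dec P) → does P? ≡ true → P
    does-true (yes p) _ = p

  Std-odometer : ∀ u v w →
    does (Std? (odometer u) (odometer v) (odometer w)) ≡ does (Std? {k} u v w)
  Std-odometer u v w
    rewrite level-odometer u v | level-odometer u w | level-odometer v w = refl

  stdRelation-invariant : Invariant stdRelation
  stdRelation-invariant = holds-injective λ x y z → begin
    holds (pullback σ stdRelation) x y z
      ≡⟨ holds-relation _ x y z ⟩
    holds stdRelation (σ x) (σ y) (σ z)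
      ≡⟨ holds-relation _ (σ x) (σ y) (σ z) ⟩
    does (Std? (vec (σ x)) (vec (σ y)) (vec (σ z)))
      ≡⟨ cong₂ (λ u v → does (Std? u v (vec (σ z)))) (vec-σ x) (vec-σ y) ⟩
    does (Std? (odometer (vec x)) (odometer (vec y)) (vec (σ z)))
      ≡⟨ cong (λ w → does (Std? (odometer (vec x)) (odometer (vec y)) w)) (vec-σ z) ⟩
    does (Std? (odometer (vec x)) (odometer (vec y)) (odometer (vec z)))
      ≡⟨ Std-odometer (vec x) (vec y) (vec z) ⟩
    does (Std? (vec x) (vec y) (vec z))
      ≡⟨ holds-relation _ x y z ⟨
    holds stdRelation x y z ∎
    where open ≡-Reasoning

  stdRelation-model : PowerOf2 k → stdRelation ⊨ treeSentence
  stdRelation-model pow = Model⇒⊨ stdRelation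
    (Std-model vec vec-injective (λ v → ι v , vec-ι v) Holds-stdRelation pow)

  invariant-unique : ∀ {A} → A ⊨ treeSentence → Invariant A → A ≡ stdRelation
  invariant-unique {A} A⊨ invariant = holds-injective same
    where
    holds-std : ∀ x y z → Holds A x y z ⟺ Holds stdRelation x y z
    holds-std x y z = ⟺-trans
      (subst₂ (λ a b → Holds A a b z ⟺ Std (vec x) (vec y) (vec z)) (ι-vec x) (ι-vec y)
        (subst (λ c → Holds A (ι (vec x)) (ι (vec y)) c ⟺ Std (vec x) (vec y) (vec z)) (ι-vec z)
          (InvariantModel.standard A⊨ invariant (vec x) (vec y) (vec z))))
      (⟺-sym (Holds-stdRelation x y z))

    same : ∀ x y z → holds A x y z ≡ holds stdRelation x y z
    same x y z = Bool.⇔→≡ (mk⇔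
      (λ h → ∈⇒holds stdRelation (proj₁ (holds-std x y z) (holds⇒∈ A h)))
      (λ h → ∈⇒holds A (proj₂ (holds-std x y z) (holds⇒∈ stdRelation h))))

  odd-Sp : PowerOf2 k → parity (Sp treeSentence (2 ^ k + 0)) ≡ 1ℙ
  odd-Sp pow = trans Sp-parity (cong parity (length-singleton
    (filter⁺ invariantModel? (allRelations-unique (2 ^ k + 0)))
    (∈-filter⁺ invariantModel? (allRelations-complete stdRelation)
      (stdRelation-model pow , stdRelation-invariant))
    (λ A∈ →
      let _ , A⊨ , invariant = ∈-filter⁻ invariantModel? {xs = allRelations (2 ^ k + 0)} A∈ in
      invariant-unique A⊨ invariant)))

-- Linear recurrences modulo 2

module _ {d : ℤ} where

  ∣-sum : ∀ {n} (f : Fin n → ℤ) → (∀ i → d ∣ f i) → d ∣ sum f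
  ∣-sum {zero}  f d∣f = divides (+ 0) refl
  ∣-sum {suc n} f d∣f = ∣m∣n⇒∣m+n (d∣f zero) (∣-sum (f ∘ suc) (d∣f ∘ suc))

  -- The recurrence has order p + 1, so a window of p + 1 consecutive multiples of `d` slides
  -- forward indefinitely: only its last entry is new, and the recurrence supplies it.
  zeros-persist : ∀ (s : ℕ → ℤ) p (α : Fin (suc p) → ℤ) M →
    (∀ n → M ≤ n → d ∣ s (n + p + 1) ℤ.- sum (λ i → α i ℤ.* s (n + toℕ i))) →
    (∀ i → i ≤ p → d ∣ s (M + i)) → ∀ n i → i ≤ p → d ∣ s (M + n + i)
  zeros-persist s p α M rec start zero i i≤p rewrite +-identityʳ M = start i i≤p
  zeros-persist s p α M rec start (suc n) i i≤p with i ≟ p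
  ... | no i≢p = subst (λ m → d ∣ s m)
    (trans (+-suc (M + n) i) (cong (_+ i) (sym (+-suc M n))))
    (zeros-persist s p α M rec start n (suc i) (≤∧≢⇒< i≤p i≢p))
  ... | yes refl = subst (λ m → d ∣ s m)
    (trans (+-comm (M + n + p) 1) (cong (_+ p) (sym (+-suc M n))))
    (∣m+n∣n⇒∣m {m = s (M + n + p + 1)} (rec (M + n) (m≤m+n M n))
      (∣m⇒∣-m (∣-sum _ λ i → ∣n⇒∣m*n (α i)
        (zeros-persist s p α M rec start n (toℕ i) (≤-pred (toℕ<n i))))))

parity≡0⇒2∣ : ∀ n → parity n ≡ 0ℙ → + 2 ∣ + n
parity≡0⇒2∣ zero _ = divides (+ 0) refl
parity≡0⇒2∣ (suc (suc n)) eq = ∣m∣n⇒∣m+n (divides (+ 1) refl) (parity≡0⇒2∣ n eq)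

parity≡1⇒2∤ : ∀ n → parity n ≡ 1ℙ → ¬ (+ 2 ∣ + n)
parity≡1⇒2∤ 1 _ 2∣1 with () ← ∣1⇒≡1 (∣⇒∣ᵤ 2∣1)
parity≡1⇒2∤ (suc (suc n)) eq 2∣ =
  parity≡1⇒2∤ n eq (∣m+n∣m⇒∣n {m = + 2} 2∣ (divides (+ 1) refl))

¬MCFinite-of-parity : ∀ (s : ℕ → ℕ) →
  (∀ e → parity (s (2 ^ 2 ^ e + 0)) ≡ 1ℙ) →
  (∀ e j → 0 < j → j < 2 ^ e → parity (s (2 ^ 2 ^ e + j)) ≡ 0ℙ) →
  ¬ MCFinite (λ n → + s n)
¬MCFinite-of-parity s odd even finite with r , p , _ , _ , α , rec ← finite 2 (s≤s z≤n) =
  parity≡1⇒2∤ (s K) (odd (suc e)) (subst (λ n → + 2 ∣ + s n) M+n≡K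
    (zeros-persist (λ n → + s n) p α M
      (λ n M≤n → ∣ᵤ⇒∣ (rec n (≤-trans r≤M M≤n))) zeros (K ∸ M) 0 z≤n))
  where
  -- With this `e`, the run of even values after 2 ^ k starts beyond `r` and, as p + 1 ≤ e < k,
  -- contains the window of p + 1 values from `M` on. The next value known to be odd is at `K`.
  e = r + suc p
  k = 2 ^ e
  M = 2 ^ k + 1
  K = 2 ^ 2 ^ suc e + 0

  e<k : e < k
  e<k = n<2^n e

  r≤M : r ≤ M
  r≤M = ≤-trans (m≤m+n r (suc p)) (≤-trans (<⇒≤ (<-trans e<k (n<2^n k))) (m≤m+n (2 ^ k) 1))

  M≤K : M ≤ K
  M≤K = subst₂ _≤_ (+-comm 1 (2 ^ k)) (sym (+-identityʳ _))
    (^-monoʳ-< 2 (s≤s (s≤s z≤n)) (^-monoʳ-< 2 (s≤s (s≤s z≤n)) (n<1+n e)))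

  M+n≡K : M + (K ∸ M) + 0 ≡ K
  M+n≡K = trans (+-identityʳ _) (m+[n∸m]≡n M≤K)

  zeros : ∀ i → i ≤ p → + 2 ∣ + s (M + i)
  zeros i i≤p = parity≡0⇒2∣ _ (subst (λ n → parity (s n) ≡ 0ℙ) (sym (+-assoc (2 ^ k) 1 i))
    (even e (suc i) (s≤s z≤n)
      (≤-<-trans (≤-trans (s≤s i≤p) (m≤n+m (suc p) r)) e<k)))

theorem6p3 : Σ[ φ ∈ Sentence ] (¬ MCFinite (λ n → + Sp φ n))
theorem6p3 = treeSentence , ¬MCFinite-of-parity (Sp treeSentence)
  (λ e → odd-Sp (2 ^ e) (e , refl))
  (λ e j → Rotation.even-Sp (2 ^ e) j e refl)
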